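{- Let $t\ge 2$ and let $G=K_{m_1,m_2,\ldots,m_t}$ be a complete $t$-partite graph with part sizes satisfying $m_1=m_2=\cdots=m_i<m_{i+1}\le\cdots\le m_t$ (so $i$ is the number of parts of minimum size), and let $n=\sum_{j=1}^t m_j$. Then $$ b_{\rm R}(G)=\begin{cases} \lceil i/2\rceil & \text{if } m_i=1 \text{ and } n\ge 3;\\ 2 & \text{if } m_i=2 \text{ and } i=1;\\ i & \text{if } m_i=2 \text{ and } i\ge 2;\\ n-1 & \text{if } m_i=3 \text{ and } i=t\ge 3;\\ n-m_t & \text{if } m_i\ge 3 \text{ and } m_t\ge 4. \end{cases} $$
   Context: All graphs are finite, simple and undirected. A Roman dominating function on a graph $G=(V,E)$ is a function $f:V\to\{0,1,2\}$ such that every vertex $u$ with $f(u)=0$ is adjacent to at least one vertex $v$ with $f(v)=2$; its weight is $\sum_{u\in V}f(u)$. The Roman domination number $\gamma_{\rm R}(G)$ is the minimum weight of a Roman dominating function on $G$. The Roman bondage number of a nonempty graph $G$ is $b_{\rm R}(G)=\min\{|B|: B\subseteq E(G),\ \gamma_{\rm R}(G-B)>\gamma_{\rm R}(G)\}$. -}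

module Defs where

open import Data.Nat using (ℕ; zero; suc; _+_; _≤_; _<_; _<ᵇ_)
open import Data.Bool using (Bool; true; false; _∧_; not; if_then_else_)
open import Data.Fin using (Fin; toℕ; _≟_)
open import Data.Nat.ListAction using (sum)
open import Data.List using (List; map; allFin; filter; length)
open import Data.Product using (Σ; ∃; _×_; _,_)
open import Relation.Binary.PropositionalEquality using (_≡_)
open import Relation.Nullary.Decidable using (⌊_⌋)

record Graph (n : ℕ) : Set where
  field
    adj    : Fin n → Fin n → Bool
    adjSym    : ∀ u v → adj u v ≡ adj v u
    adjIrrefl : ∀ u → adj u u ≡ false
open Graph public

sumV : ∀ {n} → (Fin n → ℕ) → ℕ
sumV {n} f = sum (map f (allFin n))

pairCount : ∀ {n} → (Fin n → Fin n → Bool) → ℕ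
pairCount {n} r =
  sumV (λ u → sumV (λ v → if (toℕ u <ᵇ toℕ v) ∧ r u v then 1 else 0))

record EdgeSubset {n} (G : Graph n) : Set where
  field
    mem    : Fin n → Fin n → Bool
    memSym : ∀ u v → mem u v ≡ mem v u
    memSub : ∀ u v → mem u v ≡ true → adj G u v ≡ true
open EdgeSubset public

size : ∀ {n} {G : Graph n} → EdgeSubset G → ℕ
size B = pairCount (mem B)

removeEdges : ∀ {n} (G : Graph n) → EdgeSubset G → Graph n
removeEdges G B = record
  { adj    = λ u v → adj G u v ∧ not (mem B u v)
  ; adjSym    = λ u v → lemma u v
  ; adjIrrefl = λ u → lemma2 u
  }
  where
  open import Relation.Binary.PropositionalEquality using (cong₂; cong)
  lemma : ∀ u v → (adj G u v ∧ not (mem B u v)) ≡ (adj G v u ∧ not (mem B v u))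
  lemma u v = cong₂ (λ a b → a ∧ not b) (adjSym G u v) (memSym B u v)
  lemma2 : ∀ u → (adj G u u ∧ not (mem B u u)) ≡ false
  lemma2 u = cong (λ a → a ∧ not (mem B u u)) (adjIrrefl G u)

IsRDF : ∀ {n} → Graph n → (Fin n → ℕ) → Set
IsRDF {n} G f =
  (∀ u → f u ≤ 2) ×
  (∀ u → f u ≡ 0 → Σ (Fin n) λ v → adj G u v ≡ true × f v ≡ 2)

weight : ∀ {n} → (Fin n → ℕ) → ℕ
weight f = sumV f

IsRomanDomNumber : ∀ {n} → Graph n → ℕ → Set
IsRomanDomNumber G k =
  (Σ _ λ f → IsRDF G f × weight f ≡ k) ×
  (∀ f → IsRDF G f → k ≤ weight f)

RaisesRDN : ∀ {n} (G : Graph n) → EdgeSubset G → Set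
RaisesRDN G B = Σ ℕ λ k → Σ ℕ λ k' →
  IsRomanDomNumber G k × IsRomanDomNumber (removeEdges G B) k' × k < k'

IsRomanBondageNumber : ∀ {n} → Graph n → ℕ → Set
IsRomanBondageNumber G b =
  (Σ (EdgeSubset G) λ B → RaisesRDN G B × size B ≡ b) ×
  (∀ (B : EdgeSubset G) → RaisesRDN G B → b ≤ size B)

completeMultipartite : ∀ {n t} → (Fin n → Fin t) → Graph n
completeMultipartite p = record
  { adj    = λ u v → not ⌊ p u ≟ p v ⌋
  ; adjSym    = λ u v → symLemma u v
  ; adjIrrefl = λ u → irr u
  }
  where
  open import Relation.Binary.PropositionalEquality using (refl; cong; sym)
  open import Relation.Nullary using (yes; no)
  symLemma : ∀ u v → not ⌊ p u ≟ p v ⌋ ≡ not ⌊ p v ≟ p u ⌋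
  symLemma u v with p u ≟ p v | p v ≟ p u
  ... | yes _ | yes _ = refl
  ... | no _  | no _  = refl
  ... | yes e | no ne = Data.Empty.⊥-elim (ne (sym e)) where import Data.Empty
  ... | no ne | yes e = Data.Empty.⊥-elim (ne (sym e)) where import Data.Empty
  irr : ∀ u → not ⌊ p u ≟ p u ⌋ ≡ false
  irr u with p u ≟ p u
  ... | yes _ = refl
  ... | no ne = Data.Empty.⊥-elim (ne refl) where import Data.Empty

partSize : ∀ {n t} → (Fin n → Fin t) → Fin t → ℕ
partSize {n} p j = length (filter (λ u → p u ≟ j) (allFin n))

{-# OPTIONS --safe #-}
-- A weight-k Roman dominating function is a pair of lists (values 1 and 2), so for k ≤ 4 at most two
-- vertices carry the value 2.  Writing μ ≤ 3 for the smallest part size, γ_R(G) = μ + 1 is attained by one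
-- vertex of a smallest part with value 2, its mates having value 1; hence B raises γ_R only if it covers
-- every vertex of a part of size μ.  For μ ≤ 2 this suffices, and a (near-)matching of these vertices is
-- optimal.
-- For μ ≥ 3 a second condition is that no two vertices dominate G − B: every pair has a common
-- neighbour in the complement of G − B (whose edges are B and the pairs inside a part).  The edges at a
-- vertex of a largest part achieve this; when all parts have size 3, its two mates need an edge each too.
-- For the lower bound, start from a part and attach the other vertices one at a time, each by an edge of
-- B: if a vertex v has no B-neighbour, every outside vertex has one in the part of v; if v has a single
-- B-neighbour c, every vertex outside the parts of v and c has one in the part of v or equal to c; and if
-- all B-degrees are at least 2 then |B| ≥ n.  When all parts have size 3 the bound so obtained is one
-- short of n − 1, and the missing edge comes from a case analysis around the leaf v.
module Submission where

open import Defs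
open import Data.Bool as Bool using (Bool; true; false; _∧_; _∨_; if_then_else_)
open import Data.Bool.Properties using (∨-comm; ∧-zeroʳ)
open import Data.Empty using (⊥)
open import Data.Fin as Fin using (Fin; toℕ; fromℕ; zero; suc)
import Data.Fin.Properties as Fin
open import Data.List using (List; []; _∷_; _++_; map; filter; length; allFin; tabulate; upTo)
import Data.List.Membership.DecPropositional as DecMembership
open import Data.List.Membership.Propositional using (_∈_; _∉_; lose)
open import Data.List.Membership.Propositional.Properties
  using (∈-allFin; ∈-filter⁺; ∈-filter⁻; ∈-∃++; ∈-++⁺ˡ; ∈-++⁺ʳ; ∈-++⁻; ∈-map⁺; ∈-upTo⁺; ∈-tabulate⁻)
open import Data.List.Properties
  using (map-cong; length-++; length-map; length-tabulate; length-upTo; filter-notAll; ++-identityʳ)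
open import Data.List.Relation.Binary.Permutation.Propositional using (↭-sym)
import Data.List.Relation.Binary.Permutation.Propositional.Properties as Perm
open import Data.List.Relation.Unary.All as All using ([]; _∷_; lookup)
open import Data.List.Relation.Unary.AllPairs using ([]; _∷_)
open import Data.List.Relation.Unary.Any using (here; there)
open import Data.List.Relation.Unary.Unique.Propositional using (Unique)
import Data.List.Relation.Unary.Unique.Propositional.Properties as Unique
open import Data.Nat using (ℕ; zero; suc; _+_; _*_; _∸_; _≤_; _<_; _<ᵇ_; ⌈_/2⌉; z≤n; s≤s)
open import Data.Nat.ListAction using (sum)
open import Data.Nat.ListAction.Properties using (sum-↭)
open import Data.Nat.Properties
open import Algebra.Properties.CommutativeSemigroup +-commutativeSemigroup using (interchange)
open import Data.Product using (Σ; ∃; _×_; _,_; proj₁; proj₂)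
open import Data.Product.Properties using (≡-dec)
open import Data.Sum as Sum using (_⊎_; inj₁; inj₂)
open import Data.Vec as Vec using (Vec)
import Data.Vec.Properties as Vec
open import Function using (_∘_; case_of_)
open import Relation.Binary.Definitions using (tri<; tri≈; tri>)
open import Relation.Binary.PropositionalEquality
open import Relation.Nullary using (¬_; Dec; yes; no; does; contradiction)
open import Relation.Nullary.Decidable
  using (dec-true; dec-false; map′; _×-dec_; _→-dec_; _⊎-dec_; ¬?; decidable-stable)
open import Relation.Unary using (Decidable)

-- Finite sums and double counting over pairs of vertices

⟦_⟧ : Bool → ℕ
⟦ b ⟧ = if b then 1 else 0

module _ {A : Set} where

  sum-mono : ∀ {f g : A → ℕ} → (∀ x → f x ≤ g x) → ∀ xs → sum (map f xs) ≤ sum (map g xs)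
  sum-mono f≤g []       = z≤n
  sum-mono f≤g (x ∷ xs) = +-mono-≤ (f≤g x) (sum-mono f≤g xs)

  sum-+ : ∀ (f g : A → ℕ) xs → sum (map (λ x → f x + g x) xs) ≡ sum (map f xs) + sum (map g xs)
  sum-+ f g []       = refl
  sum-+ f g (x ∷ xs) = trans (cong (f x + g x +_) (sum-+ f g xs))
    (interchange (f x) (g x) (sum (map f xs)) (sum (map g xs)))

  sum-* : ∀ c (f : A → ℕ) xs → sum (map (λ x → c * f x) xs) ≡ c * sum (map f xs)
  sum-* c f []       = sym (*-zeroʳ c)
  sum-* c f (x ∷ xs) = trans (cong (c * f x +_) (sum-* c f xs)) (sym (*-distribˡ-+ c (f x) _))

  sum-const : ∀ c (xs : List A) → sum (map (λ _ → c) xs) ≡ length xs * c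
  sum-const c []       = refl
  sum-const c (x ∷ xs) = cong (c +_) (sum-const c xs)

  sum-⟦⟧ : ∀ {P : A → Set} (P? : Decidable P) xs →
           sum (map (λ x → ⟦ does (P? x) ⟧) xs) ≡ length (filter P? xs)
  sum-⟦⟧ P? [] = refl
  sum-⟦⟧ P? (x ∷ xs) with does (P? x)
  ... | true  = cong suc (sum-⟦⟧ P? xs)
  ... | false = sum-⟦⟧ P? xs

  -- Each entry of `xs` uses up one occurrence in `ys`; by uniqueness the other entries find theirs
  -- among the remaining ones. With `g` constant this is the pigeonhole principle, the source of all
  -- cardinality bounds below.
  sum-unique-⊆ : ∀ (g : A → ℕ) {xs ys} → Unique xs → (∀ {x} → x ∈ xs → x ∈ ys) →
                 sum (map g xs) ≤ sum (map g ys)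
  sum-unique-⊆ g [] _ = z≤n
  sum-unique-⊆ g {x ∷ xs} {ys} (x∉ ∷ uniq) sub with ∈-∃++ (sub (here refl))
  ... | as , bs , refl = begin
    g x + sum (map g xs)          ≤⟨ +-monoʳ-≤ (g x) (sum-unique-⊆ g uniq sub′) ⟩
    sum (map g (x ∷ as ++ bs))    ≡⟨ sum-↭ (Perm.map⁺ g (↭-sym (Perm.shift x as bs))) ⟩
    sum (map g (as ++ x ∷ bs))    ∎
    where
    open ≤-Reasoning
    sub′ : ∀ {y} → y ∈ xs → y ∈ as ++ bs
    sub′ y∈ with Perm.∈-resp-↭ (Perm.shift x as bs) (sub (there y∈))
    ... | here refl = contradiction refl (lookup x∉ y∈)
    ... | there q   = q

  length-unique-⊆ : ∀ {xs ys : List A} → Unique xs → (∀ {x} → x ∈ xs → x ∈ ys) → length xs ≤ length ys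
  length-unique-⊆ {xs} {ys} uniq sub = subst₂ _≤_ (count xs) (count ys) (sum-unique-⊆ (λ _ → 1) uniq sub)
    where
    count : ∀ (zs : List A) → sum (map (λ _ → 1) zs) ≡ length zs
    count zs = trans (sum-const 1 zs) (*-identityʳ _)

sum-swap : ∀ {A B : Set} (h : A → B → ℕ) xs ys →
           sum (map (λ x → sum (map (h x) ys)) xs) ≡ sum (map (λ y → sum (map (λ x → h x y) xs)) ys)
sum-swap h []       ys = sym (trans (sum-const 0 ys) (*-zeroʳ (length ys)))
sum-swap h (x ∷ xs) ys = trans (cong (sum (map (h x) ys) +_) (sum-swap h xs ys))
  (sym (sum-+ (h x) (λ y → sum (map (λ x → h x y) xs)) ys))

length-allFin : ∀ n → length (allFin n) ≡ n
length-allFin n = length-tabulate {n = n} (λ i → i)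

module _ {n : ℕ} where

  open DecMembership (Fin._≟_ {n}) using (_∈?_) public

  ΣΣ : (Fin n → Fin n → ℕ) → ℕ
  ΣΣ h = sumV (λ u → sumV (h u))

  ΣΣ-mono : ∀ {h k : Fin n → Fin n → ℕ} → (∀ u v → h u v ≤ k u v) → ΣΣ h ≤ ΣΣ k
  ΣΣ-mono h≤k = sum-mono (λ u → sum-mono (h≤k u) (allFin n)) (allFin n)

  ΣΣ-+ : ∀ (h k : Fin n → Fin n → ℕ) → ΣΣ (λ u v → h u v + k u v) ≡ ΣΣ h + ΣΣ k
  ΣΣ-+ h k = trans (cong sum (map-cong (λ u → sum-+ (h u) (k u) (allFin n)) (allFin n)))
                   (sum-+ (λ u → sumV (h u)) (λ u → sumV (k u)) (allFin n))

  ΣΣ-* : ∀ c (h : Fin n → Fin n → ℕ) → ΣΣ (λ u v → c * h u v) ≡ c * ΣΣ h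
  ΣΣ-* c h = trans (cong sum (map-cong (λ u → sum-* c (h u) (allFin n)) (allFin n)))
                   (sum-* c (λ u → sumV (h u)) (allFin n))

  ΣΣ-swap : ∀ (h : Fin n → Fin n → ℕ) → ΣΣ h ≡ ΣΣ (λ u v → h v u)
  ΣΣ-swap h = sum-swap h (allFin n) (allFin n)

  entry≤sumV : ∀ (g : Fin n → ℕ) x → g x ≤ sumV g
  entry≤sumV g x = subst (_≤ sumV g) (+-identityʳ (g x))
    (sum-unique-⊆ g ([] ∷ []) (λ _ → ∈-allFin _))

  length-unique≤n : ∀ {xs : List (Fin n)} → Unique xs → length xs ≤ n
  length-unique≤n {xs} uniq = subst (length xs ≤_) (length-allFin n)
    (length-unique-⊆ uniq (λ _ → ∈-allFin _))

  n≤length : ∀ {xs : List (Fin n)} → (∀ u → u ∈ xs) → n ≤ length xs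
  n≤length {xs} all = subst (_≤ length xs) (length-allFin n)
    (length-unique-⊆ (Unique.allFin⁺ n) (λ {u} _ → all u))

  -- The two strict triangles of a matrix. `pairCount` sees an unordered pair only in the upper
  -- triangle, so the lower one is folded onto it by transposition.
  upper lower : (Fin n → Fin n → ℕ) → Fin n → Fin n → ℕ
  upper h u v = if toℕ u <ᵇ toℕ v then h u v else 0
  lower h u v = if toℕ v <ᵇ toℕ u then h u v else 0

  <ᵇ-trichotomy : ∀ (u v : Fin n) →
    ((toℕ u <ᵇ toℕ v) ≡ true × (toℕ v <ᵇ toℕ u) ≡ false) ⊎
    ((toℕ u <ᵇ toℕ v) ≡ false × (toℕ v <ᵇ toℕ u) ≡ true) ⊎ u ≡ v
  <ᵇ-trichotomy u v with Fin.<-cmp u v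
  ... | tri< l _ ¬g = inj₁ (dec-true (toℕ u <? toℕ v) l , dec-false (toℕ v <? toℕ u) ¬g)
  ... | tri≈ _ e _  = inj₂ (inj₂ e)
  ... | tri> ¬l _ g = inj₂ (inj₁ (dec-false (toℕ u <? toℕ v) ¬l , dec-true (toℕ v <? toℕ u) g))

  <ᵇ-irrefl : ∀ (u : Fin n) → (toℕ u <ᵇ toℕ u) ≡ false
  <ᵇ-irrefl u = dec-false (toℕ u <? toℕ u) (<-irrefl refl)

  ΣΣ-fold : ∀ (h : Fin n → Fin n → ℕ) →
            ΣΣ (λ u v → upper h u v + lower h v u) ≡ ΣΣ (λ u v → upper h u v + lower h u v)
  ΣΣ-fold h = begin
    ΣΣ (λ u v → upper h u v + lower h v u)   ≡⟨ ΣΣ-+ (upper h) (λ u v → lower h v u) ⟩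
    ΣΣ (upper h) + ΣΣ (λ u v → lower h v u)  ≡⟨ cong (ΣΣ (upper h) +_) (ΣΣ-swap (lower h)) ⟨
    ΣΣ (upper h) + ΣΣ (lower h)              ≡⟨ ΣΣ-+ (upper h) (lower h) ⟨
    ΣΣ (λ u v → upper h u v + lower h u v)   ∎
    where open ≡-Reasoning

  -- Double counting: distribute the charge h u v + h v u to the unordered pair {u,v}.
  charge≤pairCount : ∀ c (r : Fin n → Fin n → Bool) (h : Fin n → Fin n → ℕ) →
                     (∀ u → r u u ≡ false) → (∀ u v → h u v + h v u ≤ c * ⟦ r u v ⟧) →
                     ΣΣ h ≤ c * pairCount r
  charge≤pairCount c r h irr bound = begin
    ΣΣ h                                                          ≤⟨ ΣΣ-mono split ⟩
    ΣΣ (λ u v → upper h u v + lower h u v)                        ≡⟨ ΣΣ-fold h ⟨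
    ΣΣ (λ u v → upper h u v + lower h v u)                        ≤⟨ ΣΣ-mono pairs ⟩
    ΣΣ (λ u v → c * ⟦ (toℕ u <ᵇ toℕ v) ∧ r u v ⟧)                 ≡⟨ ΣΣ-* c _ ⟩
    c * pairCount r                                               ∎
    where
    open ≤-Reasoning
    -- Both triangles omit the diagonal, so nothing may be charged there; irreflexivity of `r`
    -- forces this.
    diagonal : ∀ u → h u u ≡ 0
    diagonal u = n≤0⇒n≡0 (≤-trans (m≤m+n (h u u) (h u u))
      (subst (h u u + h u u ≤_) (trans (cong (λ b → c * ⟦ b ⟧) (irr u)) (*-zeroʳ c)) (bound u u)))
    split : ∀ u v → h u v ≤ upper h u v + lower h u v
    split u v with <ᵇ-trichotomy u v
    ... | inj₁ (p , q) rewrite p | q = m≤m+n _ 0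
    ... | inj₂ (inj₁ (p , q)) rewrite p | q = ≤-refl
    ... | inj₂ (inj₂ refl) rewrite diagonal u = z≤n
    pairs : ∀ u v → upper h u v + lower h v u ≤ c * ⟦ (toℕ u <ᵇ toℕ v) ∧ r u v ⟧
    pairs u v with toℕ u <ᵇ toℕ v
    ... | true  = bound u v
    ... | false = z≤n

  -- The dual bound: every pair in `r` is paid for from at least one of its two sides. Omitting the
  -- diagonal only helps here.
  pairCount≤charge : ∀ (r : Fin n → Fin n → Bool) (h : Fin n → Fin n → ℕ) →
                     (∀ u v → ⟦ r u v ⟧ ≤ h u v + h v u) → pairCount r ≤ ΣΣ h
  pairCount≤charge r h bound = begin
    pairCount r                               ≤⟨ ΣΣ-mono pairs ⟩
    ΣΣ (λ u v → upper h u v + lower h v u)    ≡⟨ ΣΣ-fold h ⟩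
    ΣΣ (λ u v → upper h u v + lower h u v)    ≤⟨ ΣΣ-mono join ⟩
    ΣΣ h                                      ∎
    where
    open ≤-Reasoning
    join : ∀ u v → upper h u v + lower h u v ≤ h u v
    join u v with <ᵇ-trichotomy u v
    ... | inj₁ (p , q) rewrite p | q = ≤-reflexive (+-identityʳ _)
    ... | inj₂ (inj₁ (p , q)) rewrite p | q = ≤-refl
    ... | inj₂ (inj₂ refl) rewrite <ᵇ-irrefl u = z≤n
    pairs : ∀ u v → ⟦ (toℕ u <ᵇ toℕ v) ∧ r u v ⟧ ≤ upper h u v + lower h v u
    pairs u v with toℕ u <ᵇ toℕ v
    ... | true  = bound u v
    ... | false = z≤n

  -- The matrix unit at `(x , y)`, serving as the charge of one arc.
  single : Fin n → Fin n → Fin n → Fin n → ℕ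
  single x y u v = if does (u Fin.≟ x) then ⟦ does (v Fin.≟ y) ⟧ else 0

  ΣΣ-single≤1 : ∀ x y → ΣΣ (single x y) ≤ 1
  ΣΣ-single≤1 x y = begin
    ΣΣ (single x y)                     ≤⟨ sum-mono row (allFin n) ⟩
    sumV (λ u → ⟦ does (u Fin.≟ x) ⟧)   ≤⟨ δ≤1 x ⟩
    1                                   ∎
    where
    open ≤-Reasoning
    δ≤1 : ∀ x → sumV (λ u → ⟦ does (u Fin.≟ x) ⟧) ≤ 1
    δ≤1 x = subst (_≤ 1) (sym (sum-⟦⟧ (Fin._≟ x) (allFin n)))
      (length-unique-⊆ {ys = x ∷ []} (Unique.filter⁺ (Fin._≟ x) (Unique.allFin⁺ n))
        (λ {u} u∈ → here (proj₂ (∈-filter⁻ (Fin._≟ x) {xs = allFin n} u∈))))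
    row : ∀ u → sumV (single x y u) ≤ ⟦ does (u Fin.≟ x) ⟧
    row u with does (u Fin.≟ x)
    ... | true  = δ≤1 y
    ... | false = ≤-reflexive (trans (sum-const 0 (allFin n)) (*-zeroʳ (length (allFin n))))

-- Roman dominating functions and their supports

-- Vectors over a finite alphabet can be searched exhaustively, which makes the existence of a Roman
-- dominating function of bounded weight decidable.
anyVec? : ∀ {k n} {P : Vec (Fin k) n → Set} → Decidable P → Dec (∃ P)
anyVec? {n = zero}  P? = map′ (Vec.[] ,_) (λ { (Vec.[] , p) → p }) (P? Vec.[])
anyVec? {n = suc n} P? = map′ (λ { (x , xs , p) → x Vec.∷ xs , p }) (λ { (x Vec.∷ xs , p) → x , xs , p })
  (Fin.any? λ x → anyVec? λ xs → P? (x Vec.∷ xs))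

module _ {n} (H : Graph n) where

  HasRDF : ℕ → Set
  HasRDF k = ∃ λ f → IsRDF H f × weight f ≤ k

  isRDF? : ∀ f → Dec (IsRDF H f)
  isRDF? f = Fin.all? (λ u → f u ≤? 2) ×-dec
    Fin.all? (λ u → (f u ≟ 0) →-dec Fin.any? λ v → (adj H u v Bool.≟ true) ×-dec (f v ≟ 2))

  IsRDF-resp : ∀ {f g} → (∀ u → f u ≡ g u) → IsRDF H f → IsRDF H g
  IsRDF-resp f≗g (f≤2 , dom) =
    (λ u → subst (_≤ 2) (f≗g u) (f≤2 u)) ,
    λ u gu≡0 → case dom u (trans (f≗g u) gu≡0) of λ
      { (v , uv , fv≡2) → v , uv , trans (sym (f≗g v)) fv≡2 }

  hasRDF? : ∀ k → Dec (HasRDF k)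
  hasRDF? k = map′ (λ { (xs , p) → toℕ ∘ Vec.lookup xs , p }) tabulated
    (anyVec? {3} λ xs → isRDF? (toℕ ∘ Vec.lookup xs) ×-dec (weight (toℕ ∘ Vec.lookup xs) ≤? k))
    where
    tabulated : HasRDF k → ∃ λ (xs : Vec (Fin 3) n) →
      IsRDF H (toℕ ∘ Vec.lookup xs) × weight (toℕ ∘ Vec.lookup xs) ≤ k
    tabulated (f , rdf@(f≤2 , _) , w≤k) = xs , IsRDF-resp same rdf ,
      ≤-trans (sum-mono (λ u → ≤-reflexive (sym (same u))) (allFin n)) w≤k
      where
      xs = Vec.tabulate λ u → Fin.fromℕ< (s≤s (f≤2 u))
      same : ∀ u → f u ≡ toℕ (Vec.lookup xs u)
      same u = sym (trans (cong toℕ (Vec.lookup∘tabulate _ u)) (Fin.toℕ-fromℕ< _))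

  -- Descends from an attainable bound `k`; `hasRDF?` tells at each level whether a smaller weight
  -- is possible. The minimum is needed as data because `RaisesRDN` asks for both domination
  -- numbers.
  minimumRDF : ∀ k → HasRDF k → ∃ λ γ → IsRomanDomNumber H γ
  minimumRDF zero (f , rdf , w≤0) = 0 , (f , rdf , n≤0⇒n≡0 w≤0) , λ _ _ → z≤n
  minimumRDF (suc k) (f , rdf , w≤) with hasRDF? k
  ... | yes smaller = minimumRDF k smaller
  ... | no none = suc k , (f , rdf , ≤-antisym w≤ (larger f rdf)) , larger
    where
    larger : ∀ g → IsRDF H g → suc k ≤ weight g
    larger g r = ≰⇒> λ w≤k → none (g , r , w≤k)

  romanDomNumber : ∃ λ γ → IsRomanDomNumber H γ
  -- The constant function 1 leaves no vertex to dominate, so it starts the descent.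
  romanDomNumber = minimumRDF _ ((λ _ → 1) , ((λ _ → s≤s z≤n) , λ _ ()) , ≤-refl)

  -- The lists may repeat or overlap, which only raises `cost`. For small `k`, matching on `twos`
  -- leaves a handful of shapes.
  record Cover (k : ℕ) : Set where
    constructor cover
    field
      ones twos : List (Fin n)
      cost      : length ones + 2 * length twos ≤ k
      covered   : ∀ u → u ∈ ones ⊎ u ∈ twos ⊎ ∃ λ v → v ∈ twos × adj H u v ≡ true

  RDF⇒Cover : ∀ {k} → HasRDF k → Cover k
  RDF⇒Cover {k} (f , (f≤2 , dom) , w≤k) = record
    { ones = filter is1? (allFin n)
    ; twos = filter is2? (allFin n)
    ; cost = ≤-trans cost′ w≤k
    ; covered = λ u → classify u (f u) refl
    }
    where
    is1? is2? : Decidable _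
    is1? u = f u ≟ 1
    is2? u = f u ≟ 2
    pointwise : ∀ m → ⟦ does (m ≟ 1) ⟧ + 2 * ⟦ does (m ≟ 2) ⟧ ≤ m
    pointwise 0 = z≤n
    pointwise 1 = ≤-refl
    pointwise 2 = ≤-refl
    pointwise (suc (suc (suc m))) = z≤n
    cost′ : length (filter is1? (allFin n)) + 2 * length (filter is2? (allFin n)) ≤ weight f
    cost′ = begin
      length (filter is1? (allFin n)) + 2 * length (filter is2? (allFin n))
        ≡⟨ cong₂ (λ a b → a + 2 * b) (sum-⟦⟧ is1? (allFin n)) (sum-⟦⟧ is2? (allFin n)) ⟨
      sumV (λ u → ⟦ does (is1? u) ⟧) + 2 * sumV (λ u → ⟦ does (is2? u) ⟧)
        ≡⟨ cong (sumV (λ u → ⟦ does (is1? u) ⟧) +_) (sum-* 2 _ (allFin n)) ⟨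
      sumV (λ u → ⟦ does (is1? u) ⟧) + sumV (λ u → 2 * ⟦ does (is2? u) ⟧)
        ≡⟨ sum-+ _ _ (allFin n) ⟨
      sumV (λ u → ⟦ does (is1? u) ⟧ + 2 * ⟦ does (is2? u) ⟧)
        ≤⟨ sum-mono (pointwise ∘ f) (allFin n) ⟩
      weight f ∎
      where open ≤-Reasoning
    classify : ∀ u m → f u ≡ m → u ∈ filter is1? (allFin n) ⊎ u ∈ filter is2? (allFin n) ⊎
               ∃ λ v → v ∈ filter is2? (allFin n) × adj H u v ≡ true
    classify u 0 e with dom u e
    ... | v , uv , fv = inj₂ (inj₂ (v , ∈-filter⁺ is2? (∈-allFin v) fv , uv))
    classify u 1 e = inj₁ (∈-filter⁺ is1? (∈-allFin u) e)
    classify u 2 e = inj₂ (inj₁ (∈-filter⁺ is2? (∈-allFin u) e))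
    classify u (suc (suc (suc m))) e with subst (_≤ 2) e (f≤2 u)
    ... | s≤s (s≤s ())

  Cover⇒RDF : ∀ {k} → Cover k → HasRDF k
  Cover⇒RDF {k} (cover ones twos cost covered) = f , (f≤2 , dom) , ≤-trans weight≤ cost
    where
    f : Fin n → ℕ
    -- On an overlap the label 2 wins, and the entry in `ones` is merely wasted cost.
    f u = if does (u ∈? twos) then 2 else ⟦ does (u ∈? ones) ⟧
    f≤2 : ∀ u → f u ≤ 2
    f≤2 u with does (u ∈? twos) | does (u ∈? ones)
    ... | true  | _     = ≤-refl
    ... | false | true  = s≤s z≤n
    ... | false | false = z≤n
    f-twos : ∀ {u} → u ∈ twos → f u ≡ 2
    f-twos {u} u∈ rewrite dec-true (u ∈? twos) u∈ = refl
    dom : ∀ u → f u ≡ 0 → Σ (Fin n) λ v → adj H u v ≡ true × f v ≡ 2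
    dom u fu≡0 with covered u
    ... | inj₂ (inj₂ (v , v∈ , uv)) = v , uv , f-twos v∈
    ... | inj₂ (inj₁ u∈) = case trans (sym fu≡0) (f-twos u∈) of λ ()
    ... | inj₁ u∈ rewrite dec-true (u ∈? ones) u∈ with does (u ∈? twos) | fu≡0
    ...   | true  | ()
    ...   | false | ()
    listed : ∀ xs → sumV (λ u → ⟦ does (u ∈? xs) ⟧) ≤ length xs
    listed xs = subst (_≤ length xs) (sym (sum-⟦⟧ (_∈? xs) (allFin n)))
      (length-unique-⊆ (Unique.filter⁺ (_∈? xs) (Unique.allFin⁺ n))
        λ u∈ → proj₂ (∈-filter⁻ (_∈? xs) {xs = allFin n} u∈))
    pointwise : ∀ u → f u ≤ ⟦ does (u ∈? ones) ⟧ + 2 * ⟦ does (u ∈? twos) ⟧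
    pointwise u with does (u ∈? twos)
    ... | true  = m≤n+m 2 _
    ... | false = m≤m+n _ 0
    weight≤ : weight f ≤ length ones + 2 * length twos
    weight≤ = begin
      weight f ≤⟨ sum-mono pointwise (allFin n) ⟩
      sumV (λ u → ⟦ does (u ∈? ones) ⟧ + 2 * ⟦ does (u ∈? twos) ⟧) ≡⟨ sum-+ _ _ (allFin n) ⟩
      sumV (λ u → ⟦ does (u ∈? ones) ⟧) + sumV (λ u → 2 * ⟦ does (u ∈? twos) ⟧)
        ≡⟨ cong (sumV (λ u → ⟦ does (u ∈? ones) ⟧) +_) (sum-* 2 _ (allFin n)) ⟩
      sumV (λ u → ⟦ does (u ∈? ones) ⟧) + 2 * sumV (λ u → ⟦ does (u ∈? twos) ⟧)
        ≤⟨ +-mono-≤ (listed ones) (*-monoʳ-≤ 2 (listed twos)) ⟩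
      length ones + 2 * length twos ∎
      where open ≤-Reasoning

module _ {n} {G : Graph n} {B : EdgeSubset G} where

  -- The threshold `k` separates the two domination numbers, so neither has to be computed.
  raises : ∀ {k} → Cover G k → ¬ Cover (removeEdges G B) k → RaisesRDN G B
  raises coverG uncover with romanDomNumber G | romanDomNumber (removeEdges G B) | Cover⇒RDF G coverG
  ... | γ , isγ | γ′ , isγ′@((f′ , rdf′ , w′) , _) | f , rdf , w≤k =
    γ , γ′ , isγ , isγ′ , ≰⇒> λ γ′≤γ → uncover (RDF⇒Cover _
      (f′ , rdf′ , ≤-trans (≤-reflexive w′) (≤-trans γ′≤γ (≤-trans (proj₂ isγ f rdf) w≤k))))

  -- Strictness gains one: a cover of weight `k + 1` after the removal would force the original
  -- number down to `k`.
  raised : ∀ {k} → RaisesRDN G B → ¬ Cover G k → ¬ Cover (removeEdges G B) (suc k)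
  raised (γ , γ′ , ((f , rdf , w) , _) , (_ , min) , γ<γ′) uncover coverGB
    with Cover⇒RDF _ coverGB
  ... | f′ , rdf′ , w′ = uncover (RDF⇒Cover _
    (f , rdf , ≤-trans (≤-reflexive w) (≤-pred (≤-trans γ<γ′ (≤-trans (min f′ rdf′) w′)))))

-- Edge sets given by lists of arcs

module _ {n} (G : Graph n) where

  open DecMembership (≡-dec (Fin._≟_ {n}) (Fin._≟_ {n}))
    using () renaming (_∈?_ to _∈arcs?_)

  abstract
    -- The list is symmetrised and intersected with `G`, so any list is admissible. Later proofs use
    -- it only through `arcSet-mem` and `size-arcSet`.
    arcSet : List (Fin n × Fin n) → EdgeSubset G
    arcSet arcs = record
      { mem    = λ u v → adj G u v ∧ (listed u v ∨ listed v u)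
      ; memSym = λ u v → cong₂ _∧_ (adjSym G u v) (∨-comm (listed u v) (listed v u))
      ; memSub = λ u v → project (adj G u v)
      }
      where
      listed : Fin n → Fin n → Bool
      listed u v = does ((u , v) ∈arcs? arcs)
      project : ∀ a {b} → a ∧ b ≡ true → a ≡ true
      project true _ = refl

    arcSet-mem : ∀ {arcs u v} → (u , v) ∈ arcs → adj G u v ≡ true → mem (arcSet arcs) u v ≡ true
    arcSet-mem {arcs} {u} {v} uv∈ a rewrite a | dec-true ((u , v) ∈arcs? arcs) uv∈ = refl

    -- Each arc pays for one unordered pair. Repetitions, reversals and non-edges are allowed in the
    -- list, hence only an inequality.
    size-arcSet : ∀ arcs → size (arcSet arcs) ≤ length arcs
    size-arcSet arcs = ≤-trans (pairCount≤charge (mem (arcSet arcs)) (charge arcs) bound) (total arcs)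
      where
      charge : List (Fin n × Fin n) → Fin n → Fin n → ℕ
      charge []             u v = 0
      charge ((x , y) ∷ as) u v = single x y u v + charge as u v
      total : ∀ as → ΣΣ (charge as) ≤ length as
      total [] = ≤-reflexive (ΣΣ-* {n} 0 (λ _ _ → 0))
      total ((x , y) ∷ as) = ≤-trans (≤-reflexive (ΣΣ-+ (single x y) (charge as)))
        (+-mono-≤ (ΣΣ-single≤1 x y) (total as))
      charged : ∀ {as u v} → (u , v) ∈ as → 1 ≤ charge as u v
      charged {(x , y) ∷ as} {u} {v} (here refl)
        rewrite dec-true (x Fin.≟ x) refl | dec-true (y Fin.≟ y) refl = s≤s z≤n
      charged {(x , y) ∷ as} {u} {v} (there q) = ≤-trans (charged q) (m≤n+m _ (single x y u v))
      bound : ∀ u v → ⟦ mem (arcSet arcs) u v ⟧ ≤ charge arcs u v + charge arcs v u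
      bound u v with adj G u v | (u , v) ∈arcs? arcs | (v , u) ∈arcs? arcs
      ... | false | _     | _     = z≤n
      ... | true  | yes p | _     = ≤-trans (charged p) (m≤m+n _ _)
      ... | true  | no _  | yes q = ≤-trans (charged q) (m≤n+m _ _)
      ... | true  | no _  | no _  = z≤n

-- Counting the edges of `B`

module Counting {n} {G : Graph n} (B : EdgeSubset G) where

  infix 4 _~_
  _~_ : Fin n → Fin n → Set
  u ~ v = mem B u v ≡ true

  _~?_ : ∀ u v → Dec (u ~ v)
  u ~? v = mem B u v Bool.≟ true

  ~-sym : ∀ {u v} → u ~ v → v ~ u
  ~-sym {u} {v} uv = trans (memSym B v u) uv

  ~-irrefl : ∀ {u} → ¬ u ~ u
  ~-irrefl {u} uu = case trans (sym (memSub B u u uu)) (adjIrrefl G u) of λ ()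

  mem-irrefl : ∀ u → mem B u u ≡ false
  mem-irrefl u with mem B u u in eq
  ... | true  = contradiction eq ~-irrefl
  ... | false = refl

  degree : Fin n → ℕ
  degree u = sumV λ v → ⟦ mem B u v ⟧

  handshake : sumV degree ≤ 2 * size B
  handshake = charge≤pairCount 2 (mem B) (λ u v → ⟦ mem B u v ⟧) mem-irrefl λ u v → ≤-reflexive
    (cong (⟦ mem B u v ⟧ +_) (trans (cong ⟦_⟧ (memSym B v u)) (sym (+-identityʳ _))))

  private
    length*≤sum : ∀ c (g : Fin n → ℕ) xs → (∀ {x} → x ∈ xs → c ≤ g x) → length xs * c ≤ sum (map g xs)
    length*≤sum c g []       _  = z≤n
    length*≤sum c g (x ∷ xs) c≤ = +-mono-≤ (c≤ (here refl)) (length*≤sum c g xs (c≤ ∘ there))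

  length≤degree : ∀ {u vs} → Unique vs → (∀ {v} → v ∈ vs → u ~ v) → length vs ≤ degree u
  length≤degree {u} {vs} uniq adjacent = ≤-trans
    (subst (_≤ sum (map (λ v → ⟦ mem B u v ⟧) vs)) (*-identityʳ (length vs))
      (length*≤sum 1 (λ v → ⟦ mem B u v ⟧) vs λ v∈ → ≤-reflexive (sym (cong ⟦_⟧ (adjacent v∈)))))
    (sum-unique-⊆ (λ v → ⟦ mem B u v ⟧) uniq (λ _ → ∈-allFin _))

  degrees≤2size : ∀ c {us} → Unique us → (∀ {u} → u ∈ us → c ≤ degree u) → length us * c ≤ 2 * size B
  degrees≤2size c {us} uniq c≤ = ≤-trans (length*≤sum c degree us c≤)
    (≤-trans (sum-unique-⊆ degree uniq (λ _ → ∈-allFin _)) handshake)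

  -- One edge covers at most two vertices: the degree sum with all degrees at least 1.
  covered≤2size : ∀ {us} → Unique us → (∀ {u} → u ∈ us → ∃ (u ~_)) → length us ≤ 2 * size B
  covered≤2size uniq covered = subst (_≤ 2 * size B) (*-identityʳ _) (degrees≤2size 1 uniq
    λ u∈ → case covered u∈ of λ { (v , uv) → length≤degree ([] ∷ []) λ { (here refl) → uv } })

  Leaf : Fin n → Set
  Leaf u = ∃ λ v → u ~ v × (∀ x → u ~ x → x ≡ v)

  isolated-leaf-or-branch : ∀ u → (∀ v → ¬ u ~ v) ⊎ Leaf u ⊎ (2 ≤ degree u)
  isolated-leaf-or-branch u with Fin.any? (u ~?_)
  ... | no none = inj₁ λ v uv → none (v , uv)
  ... | yes (v , uv) with Fin.any? (λ x → (u ~? x) ×-dec ¬? (x Fin.≟ v))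
  ...   | no none = inj₂ (inj₁ (v , uv , λ x ux → decidable-stable (x Fin.≟ v) λ x≢v → none (x , ux , x≢v)))
  ...   | yes (x , ux , x≢v) = inj₂ (inj₂ (length≤degree ((x≢v ∷ []) ∷ [] ∷ [])
          λ { (here refl) → ux ; (there (here refl)) → uv }))

  -- At least k edges lie inside S, counted at the later-inserted endpoint.
  data Dense : List (Fin n) → ℕ → Set where
    empty  : Dense [] 0
    insert : ∀ {S k x ys} → x ∉ S → Unique ys → (∀ {y} → y ∈ ys → y ∈ S × x ~ y) →
             Dense S k → Dense (x ∷ S) (length ys + k)

  private
    -- A 0-1 charge of arcs in which each edge is charged at most once. `support` keeps it away from
    -- vertices outside `S`, so that the edges at a newly inserted vertex are still uncharged.
    record Charge (S : List (Fin n)) (k : ℕ) : Set where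
      field
        charge  : Fin n → Fin n → ℕ
        bound   : ∀ u v → charge u v + charge v u ≤ 1 * ⟦ mem B u v ⟧
        support : ∀ {u} v → u ∉ S → charge u v ≡ 0 × charge v u ≡ 0
        total   : k ≤ ΣΣ charge

    dense⇒charge : ∀ {S k} → Dense S k → Charge S k
    dense⇒charge empty = record
      { charge = λ _ _ → 0 ; bound = λ _ _ → z≤n ; support = λ _ _ → refl , refl ; total = z≤n }
    dense⇒charge (insert {S} {k} {x} {ys} x∉S uniq nbrs dense) = record
      { charge = λ u v → charge u v + star u v ; bound = bound′ ; support = support′ ; total = total′ }
      where
      open Charge (dense⇒charge dense)
      -- The new edges are charged from `x` towards `ys`. The old charge vanishes at `x`, so the two
      -- charges never meet on the same pair.
      star : Fin n → Fin n → ℕ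
      star u v = if does (u Fin.≟ x) then ⟦ does (v ∈? ys) ⟧ else 0
      star-off : ∀ {u} v → u ≢ x → star u v ≡ 0
      star-off {u} v u≢x rewrite dec-false (u Fin.≟ x) u≢x = refl
      star-on : ∀ v → star x v ≡ ⟦ does (v ∈? ys) ⟧
      star-on v rewrite dec-true (x Fin.≟ x) refl = refl
      star-∉ : ∀ u {v} → v ∉ ys → star u v ≡ 0
      star-∉ u {v} v∉ rewrite dec-false (v ∈? ys) v∉ with does (u Fin.≟ x)
      ... | true  = refl
      ... | false = refl
      x∉ys : x ∉ ys
      x∉ys x∈ = x∉S (proj₁ (nbrs x∈))
      from-x : ∀ v → (charge x v + star x v) + (charge v x + star v x) ≤ 1 * ⟦ mem B x v ⟧
      from-x v rewrite proj₁ (support v x∉S) | proj₂ (support v x∉S) | star-∉ v x∉ys | star-on v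
        | +-identityʳ (⟦ does (v ∈? ys) ⟧) | +-identityʳ ⟦ mem B x v ⟧ with v ∈? ys
      ... | yes v∈ rewrite proj₂ (nbrs v∈) = ≤-refl
      ... | no _ = z≤n
      bound′ : ∀ u v → (charge u v + star u v) + (charge v u + star v u) ≤ 1 * ⟦ mem B u v ⟧
      bound′ u v = cases (u Fin.≟ x) (v Fin.≟ x)
        where
        cases : Dec (u ≡ x) → Dec (v ≡ x) → (charge u v + star u v) + (charge v u + star v u) ≤ 1 * ⟦ mem B u v ⟧
        cases (yes refl) _ = from-x v
        cases (no _) (yes refl) = subst₂ _≤_ (+-comm (charge x u + star x u) (charge u x + star u x))
          (cong (λ b → 1 * ⟦ b ⟧) (memSym B x u)) (from-x u)
        cases (no u≢x) (no v≢x) rewrite star-off v u≢x | star-off u v≢x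
          | +-identityʳ (charge u v) | +-identityʳ (charge v u) = bound u v
      support′ : ∀ {u} v → u ∉ x ∷ S → charge u v + star u v ≡ 0 × charge v u + star v u ≡ 0
      support′ {u} v u∉ with support v (u∉ ∘ there)
      ... | p , q rewrite p | q | star-off v (u∉ ∘ here)
        | star-∉ v {u} (λ u∈ → u∉ (there (proj₁ (nbrs u∈)))) = refl , refl
      total′ : length ys + k ≤ ΣΣ (λ u v → charge u v + star u v)
      total′ = begin
        length ys + k         ≤⟨ +-mono-≤ row total ⟩
        ΣΣ star + ΣΣ charge   ≡⟨ +-comm (ΣΣ star) _ ⟩
        ΣΣ charge + ΣΣ star   ≡⟨ ΣΣ-+ charge star ⟨
        ΣΣ (λ u v → charge u v + star u v) ∎
        where
        open ≤-Reasoning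
        row : length ys ≤ ΣΣ star
        row = begin
          length ys                            ≤⟨ length-unique-⊆ uniq (λ {y} y∈ → ∈-filter⁺ (_∈? ys) (∈-allFin y) y∈) ⟩
          length (filter (_∈? ys) (allFin n))  ≡⟨ sum-⟦⟧ (_∈? ys) (allFin n) ⟨
          sumV (λ v → ⟦ does (v ∈? ys) ⟧)      ≤⟨ sum-mono (λ v → ≤-reflexive (sym (star-on v))) (allFin n) ⟩
          sumV (star x)                        ≤⟨ entry≤sumV (λ u → sumV (star u)) x ⟩
          ΣΣ star                              ∎

  dense≤size : ∀ {S k} → Dense S k → k ≤ size B
  dense≤size dense = ≤-trans total
    (subst (ΣΣ charge ≤_) (+-identityʳ (size B)) (charge≤pairCount 1 (mem B) charge mem-irrefl bound))
    where open Charge (dense⇒charge dense)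

  -- `d` bounds the number of vertices minus the number of counted edges; for a forest this
  -- difference is the number of trees. Inserting a vertex with no, one or two edges into `S`
  -- changes `d` by 1, 0 or -1.
  Grown : ℕ → List (Fin n) → Set
  Grown d S = ∃ λ k → Dense S k × length S ≤ k + d

  grown-[] : Grown 0 []
  grown-[] = 0 , empty , z≤n

  add₀ : ∀ {d S x} → x ∉ S → Grown d S → Grown (suc d) (x ∷ S)
  add₀ {d} {S} x∉S (k , dense , len) = k , insert x∉S [] (λ ()) dense ,
    subst (suc (length S) ≤_) (sym (+-suc k d)) (s≤s len)

  add₁ : ∀ {d S x} y → x ∉ S → y ∈ S → x ~ y → Grown d S → Grown d (x ∷ S)
  add₁ y x∉S y∈S xy (k , dense , len) =
    suc k , insert x∉S ([] ∷ []) (λ { (here refl) → y∈S , xy }) dense , s≤s len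

  add₂ : ∀ {d S x} y z → y ≢ z → x ∉ S → y ∈ S → z ∈ S → x ~ y → x ~ z → Grown (suc d) S → Grown d (x ∷ S)
  add₂ {d} {S} y z y≢z x∉S y∈S z∈S xy xz (k , dense , len) =
    suc (suc k) , insert x∉S ((y≢z ∷ []) ∷ [] ∷ [])
      (λ { (here refl) → y∈S , xy ; (there (here refl)) → z∈S , xz }) dense ,
    s≤s (subst (length S ≤_) (+-suc k d) len)

  grown-length : ∀ {d S} → Grown d S → length S ≤ size B + d
  grown-length {d} (k , dense , len) = ≤-trans len (+-monoˡ-≤ d (dense≤size dense))

  -- The anchors are taken in the original `S`, which survives every insertion, so the order of `xs`
  -- does not matter; vertices already present are skipped.
  grow : ∀ {d S} xs → (∀ {x} → x ∈ xs → x ∈ S ⊎ ∃ λ y → y ∈ S × x ~ y) → Grown d S →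
         ∃ λ S′ → Grown d S′ × (∀ {u} → u ∈ S → u ∈ S′) × (∀ {x} → x ∈ xs → x ∈ S′)
  grow {S = S} [] _ g = S , g , (λ u∈ → u∈) , λ ()
  grow (x ∷ xs) reach g with grow xs (reach ∘ there) g
  ... | S′ , g′ , S⊆S′ , xs⊆S′ with x ∈? S′ | reach (here refl)
  ...   | yes x∈ | _ = S′ , g′ , S⊆S′ , λ { (here refl) → x∈ ; (there q) → xs⊆S′ q }
  ...   | no x∉  | inj₁ x∈ = contradiction (S⊆S′ x∈) x∉
  ...   | no x∉  | inj₂ (y , y∈ , xy) = x ∷ S′ , add₁ y x∉ (S⊆S′ y∈) xy g′ , there ∘ S⊆S′ ,
          λ { (here refl) → here refl ; (there q) → there (xs⊆S′ q) }

  grow-filter : ∀ {d S} {P : Fin n → Set} → Decidable P →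
                (∀ {x} → P x → x ∈ S ⊎ ∃ λ y → y ∈ S × x ~ y) → Grown d S →
                ∃ λ S′ → Grown d S′ × (∀ {u} → u ∈ S → u ∈ S′) × (∀ {x} → P x → x ∈ S′)
  grow-filter P? reach g with grow (filter P? (allFin n)) (reach ∘ proj₂ ∘ ∈-filter⁻ P? {xs = allFin n}) g
  ... | S′ , g′ , S⊆S′ , P⊆S′ = S′ , g′ , S⊆S′ , λ {x} px → P⊆S′ (∈-filter⁺ P? (∈-allFin x) px)

  spanning : ∀ {d S} → Grown d S → (∀ u → u ∈ S) → n ≤ size B + d
  spanning g all = ≤-trans (n≤length all) (grown-length g)

  -- With a common neighbour the two edges form a path on three vertices with one root; otherwise
  -- they are disjoint and span four vertices with two roots.
  two-edges : ∀ {x y} → x ≢ y → ¬ x ~ y → ∃ (x ~_) → ∃ (y ~_) → 2 ≤ size B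
  two-edges {x} {y} x≢y x≁y (u , xu) (w , yw) with u Fin.≟ w
  ... | yes refl = +-cancelʳ-≤ 1 2 (size B) (grown-length
    (add₁ u (λ { (here e) → x≢y (sym e) ; (there (here refl)) → ~-irrefl yw ; (there (there ())) }) (there (here refl)) yw
      (add₁ u (λ { (here refl) → ~-irrefl xu ; (there ()) }) (here refl) xu
        (add₀ (λ ()) grown-[]))))
  ... | no u≢w = +-cancelʳ-≤ 2 2 (size B) (grown-length
    (add₁ w (λ { (here e) → x≢y (sym e)
               ; (there (here refl)) → ~-irrefl yw
               ; (there (there (here refl))) → x≁y xu
               ; (there (there (there ()))) })
      (there (here refl)) yw
      (add₁ u (λ { (here refl) → x≁y (~-sym yw) ; (there (here refl)) → ~-irrefl xu ; (there (there ())) })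
        (there (here refl)) xu
        (add₀ (λ { (here e) → u≢w (sym e) ; (there ()) }) (add₀ (λ ()) grown-[])))))

-- Excluding covers of weight at most four

module _ {n} (H : Graph n) where

  -- v itself counts: v is not adjacent to v.
  NonNeighbours : ℕ → Fin n → Set
  NonNeighbours k v = ∃ λ xs → Unique xs × k ≤ length xs × (∀ {x} → x ∈ xs → adj H x v ≢ true)

  -- By the number of vertices labelled 2. With none, `k < n` is contradicted. With one vertex `v`,
  -- all its non-neighbours except itself need label 1, which costs too much. With two, the cost
  -- forces `k = 4` and no further labels, and `pair` names an undominated vertex. Anything else
  -- costs more than 4.
  uncoverable : ∀ {k} → k ≤ 4 → k < n → (∀ v → NonNeighbours k v) →
                (k ≡ 4 → ∀ v w → ∃ λ u → u ≢ v × u ≢ w × adj H u v ≢ true × adj H u w ≢ true) →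
                ¬ Cover H k
  uncoverable k≤4 k<n single pair (cover ones [] cost covered) =
    <⇒≱ k<n (≤-trans (n≤length in-ones) (≤-trans (m≤m+n _ 0) cost))
    where
    in-ones : ∀ u → u ∈ ones
    in-ones u with covered u
    ... | inj₁ u∈ = u∈
    ... | inj₂ (inj₁ ())
    ... | inj₂ (inj₂ (_ , () , _))
  uncoverable {k} k≤4 k<n single pair (cover ones (v ∷ []) cost covered) with single v
  ... | xs , uniq , k≤ , nonadj = <-irrefl refl (begin-strict
    k                ≤⟨ k≤ ⟩
    length xs        ≤⟨ length-unique-⊆ uniq xs⊆ ⟩
    suc (length ones) <⟨ n<1+n _ ⟩
    2 + length ones  ≡⟨ +-comm 2 _ ⟩
    length ones + 2  ≤⟨ cost ⟩
    k                ∎)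
    where
    open ≤-Reasoning
    xs⊆ : ∀ {x} → x ∈ xs → x ∈ v ∷ ones
    xs⊆ {x} x∈ with covered x
    ... | inj₁ q = there q
    ... | inj₂ (inj₁ (here refl)) = here refl
    ... | inj₂ (inj₂ (_ , here refl , xv)) = contradiction xv (nonadj x∈)
  uncoverable k≤4 k<n single pair (cover (_ ∷ _) (_ ∷ _ ∷ twos) cost covered) =
    <⇒≱ (≤-trans (s≤s (≤-trans (*-monoʳ-≤ 2 (s≤s (s≤s z≤n))) (m≤n+m _ _))) cost) k≤4
  uncoverable k≤4 k<n single pair (cover [] (v ∷ w ∷ _ ∷ _) cost covered) =
    <⇒≱ (≤-trans (n≤1+n 5) (≤-trans (*-monoʳ-≤ 2 (s≤s (s≤s (s≤s z≤n)))) cost)) k≤4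
  uncoverable k≤4 k<n single pair (cover [] (v ∷ w ∷ []) cost covered) with pair (≤-antisym k≤4 cost) v w
  ... | u , u≢v , u≢w , ¬uv , ¬uw with covered u
  ...   | inj₂ (inj₁ (here u≡v)) = u≢v u≡v
  ...   | inj₂ (inj₁ (there (here u≡w))) = u≢w u≡w
  ...   | inj₂ (inj₂ (_ , here refl , uv)) = ¬uv uv
  ...   | inj₂ (inj₂ (_ , there (here refl) , uw)) = ¬uw uw

-- Complete multipartite graphs and the removal of edges

module Multipartite {n t} (p : Fin n → Fin t) where

  G : Graph n
  G = completeMultipartite p

  adj⁺ : ∀ {u v} → p u ≢ p v → adj G u v ≡ true
  adj⁺ {u} {v} ne with p u Fin.≟ p v
  ... | yes e = contradiction e ne
  ... | no _  = refl

  adj⁻ : ∀ {u v} → adj G u v ≡ true → p u ≢ p v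
  adj⁻ {u} {v} uv e with p u Fin.≟ p v
  ... | yes _ = case uv of λ ()
  ... | no ne = ne e

  part : Fin t → List (Fin n)
  part j = filter (λ u → p u Fin.≟ j) (allFin n)

  ∈-part⁺ : ∀ {u j} → p u ≡ j → u ∈ part j
  ∈-part⁺ {u} {j} = ∈-filter⁺ (λ u → p u Fin.≟ j) (∈-allFin u)

  ∈-part⁻ : ∀ {u j} → u ∈ part j → p u ≡ j
  ∈-part⁻ {u} {j} = proj₂ ∘ ∈-filter⁻ (λ u → p u Fin.≟ j) {xs = allFin n}

  part-unique : ∀ j → Unique (part j)
  part-unique j = Unique.filter⁺ (λ u → p u Fin.≟ j) (Unique.allFin⁺ n)

  two-parts≤n : ∀ {j k} → j ≢ k → partSize p j + partSize p k ≤ n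
  two-parts≤n {j} {k} j≢k = subst (_≤ n) (length-++ (part j)) (length-unique≤n
    (Unique.++⁺ (part-unique j) (part-unique k)
      λ (u∈j , u∈k) → j≢k (trans (sym (∈-part⁻ u∈j)) (∈-part⁻ u∈k))))

  abstract
    larger-part : ∀ j xs → length xs < partSize p j → ∃ λ u → p u ≡ j × u ∉ xs
    larger-part j xs more with Fin.any? (λ u → (p u Fin.≟ j) ×-dec ¬? (u ∈? xs))
    ... | yes found = found
    ... | no none = contradiction (length-unique-⊆ (part-unique j)
      λ {u} u∈ → decidable-stable (u ∈? xs) λ u∉ → none (u , ∈-part⁻ u∈ , u∉)) (<⇒≱ more)

  exhausted : ∀ {j xs} → Unique xs → (∀ {x} → x ∈ xs → p x ≡ j) → partSize p j ≤ length xs →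
              ∀ {u} → p u ≡ j → u ∈ xs
  exhausted {j} {xs} uniq xs⊆ small {u} pu = decidable-stable (u ∈? xs) λ u∉ →
    <⇒≱ (s≤s small) (length-unique-⊆ {ys = part j}
      (All.tabulate (λ x∈ u≡x → u∉ (subst (_∈ xs) (sym u≡x) x∈)) ∷ uniq)
      λ { (here refl) → ∈-part⁺ pu ; (there x∈) → ∈-part⁺ (xs⊆ x∈) })

  -- Stated for any `H` because it serves twice: for `G`, and for `G − B` at a vertex that `B`
  -- misses.
  part-cover : ∀ (H : Graph n) u → (∀ x → p x ≢ p u → adj H x u ≡ true) → Cover H (suc (partSize p (p u)))
  part-cover H u adjacent = cover mates (u ∷ [])
    (subst (_≤ suc (partSize p (p u))) (+-comm 2 (length mates))
      -- Dropping `u` makes `mates` shorter than the part, which leaves room for the label 2 within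
      -- one unit above the part size.
      (s≤s (filter-notAll ≢u? (part (p u)) (lose (∈-part⁺ refl) λ u≢u → u≢u refl))))
    covered
    where
    ≢u? : Decidable (_≢ u)
    ≢u? x = ¬? (x Fin.≟ u)
    mates = filter ≢u? (part (p u))
    covered : ∀ x → x ∈ mates ⊎ x ∈ u ∷ [] ⊎ ∃ λ v → v ∈ u ∷ [] × adj H x v ≡ true
    covered x with x Fin.≟ u | p x Fin.≟ p u
    ... | yes x≡u | _      = inj₂ (inj₁ (here x≡u))
    ... | no x≢u  | yes px = inj₁ (∈-filter⁺ ≢u? (∈-part⁺ px) x≢u)
    ... | no _    | no px  = inj₂ (inj₂ (u , here refl , adjacent x px))

  -- No vertex lies in both parts, so each is adjacent to `u` or to `v`.
  two-part-cover : ∀ {u v} → p u ≢ p v → Cover G 4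
  two-part-cover {u} {v} ne = cover [] (u ∷ v ∷ []) ≤-refl covered
    where
    covered : ∀ x → x ∈ [] ⊎ x ∈ u ∷ v ∷ [] ⊎ ∃ λ y → y ∈ u ∷ v ∷ [] × adj G x y ≡ true
    covered x with p x Fin.≟ p u
    ... | no px = inj₂ (inj₂ (u , here refl , adj⁺ px))
    ... | yes px = inj₂ (inj₂ (v , there (here refl) , adj⁺ λ e → ne (trans (sym px) e)))

  G-uncoverable : ∀ {k} → k ≤ 3 → k < n → (∀ j → k ≤ partSize p j) → ¬ Cover G k
  G-uncoverable k≤3 k<n big = uncoverable G (m≤n⇒m≤1+n k≤3) k<n
    (λ v → part (p v) , part-unique (p v) , big (p v) , λ x∈ xv → adj⁻ xv (∈-part⁻ x∈))
    λ { refl → contradiction k≤3 (<⇒≱ (n<1+n 3)) }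

  module Removed (B : EdgeSubset G) where

    open Counting B public

    GB : Graph n
    GB = removeEdges G B

    -- Non-adjacency in `G − B`, the diagonal included.
    Apart : Fin n → Fin n → Set
    Apart u v = p u ≡ p v ⊎ u ~ v

    ~⇒≢part : ∀ {u v} → u ~ v → p u ≢ p v
    ~⇒≢part {u} {v} uv = adj⁻ (memSub B u v uv)

    ~⇒≢ : ∀ {u v} → u ~ v → u ≢ v
    ~⇒≢ uv refl = ~-irrefl uv

    apart? : ∀ u v → Dec (Apart u v)
    apart? u v = (p u Fin.≟ p v) ⊎-dec (u ~? v)

    apart⇒nonadj : ∀ {u v} → Apart u v → adj GB u v ≢ true
    apart⇒nonadj {u} {v} (inj₁ e) uv with p u Fin.≟ p v
    ... | yes _ = case uv of λ ()
    ... | no ne = ne e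
    apart⇒nonadj {u} {v} (inj₂ b) uv rewrite b | ∧-zeroʳ (adj G u v) = case uv of λ ()

    ¬apart⇒adj : ∀ {u v} → ¬ Apart u v → adj GB u v ≡ true
    ¬apart⇒adj {u} {v} ¬ap with p u Fin.≟ p v | mem B u v
    ... | yes e | _     = contradiction (inj₁ e) ¬ap
    ... | no _  | true  = contradiction (inj₂ refl) ¬ap
    ... | no _  | false = refl

    -- A vertex missed by `B` keeps all its edges, so `part-cover` would still work in `G − B`.
    neighbour : ∀ u → ¬ Cover GB (suc (partSize p (p u))) → ∃ (u ~_)
    neighbour u uncover with Fin.any? (u ~?_)
    ... | yes found = found
    ... | no none = contradiction (part-cover GB u λ x px → ¬apart⇒adj
      λ { (inj₁ e) → px e ; (inj₂ xu) → none (x , ~-sym xu) }) uncover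

    -- Without such a `z`, the labels 2 at `x` and `y` alone would form a cover of weight 4.
    common : ¬ Cover GB 4 → ∀ x y → ∃ λ z → z ≢ x × z ≢ y × Apart z x × Apart z y
    common uncover x y with Fin.any? (λ z → ¬? (z Fin.≟ x) ×-dec ¬? (z Fin.≟ y) ×-dec apart? z x ×-dec apart? z y)
    ... | yes found = found
    ... | no none = contradiction (cover [] (x ∷ y ∷ []) ≤-refl covered) uncover
      where
      covered : ∀ u → u ∈ [] ⊎ u ∈ x ∷ y ∷ [] ⊎ ∃ λ v → v ∈ x ∷ y ∷ [] × adj GB u v ≡ true
      covered u with u Fin.≟ x | u Fin.≟ y | apart? u x | apart? u y
      ... | yes u≡x | _ | _ | _ = inj₂ (inj₁ (here u≡x))
      ... | _ | yes u≡y | _ | _ = inj₂ (inj₁ (there (here u≡y)))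
      ... | _ | _ | no ¬ux | _ = inj₂ (inj₂ (x , here refl , ¬apart⇒adj ¬ux))
      ... | _ | _ | _ | no ¬uy = inj₂ (inj₂ (y , there (here refl) , ¬apart⇒adj ¬uy))
      ... | no u≢x | no u≢y | yes ux | yes uy = contradiction (u , u≢x , u≢y , ux , uy) none

-- Edge sets after which no two vertices dominate

search : ∀ {n} {P Q : Fin n → Set} → (∀ i → P i ⊎ Q i) → ∃ P ⊎ (∀ i → Q i)
search {zero}  _ = inj₂ λ ()
search {suc n} f with f zero | search (f ∘ suc)
... | inj₁ p | _            = inj₁ (zero , p)
... | inj₂ _ | inj₁ (i , p) = inj₁ (suc i , p)
... | inj₂ q | inj₂ qs      = inj₂ λ { zero → q ; (suc i) → qs i }

module Undominated {n t} (p : Fin n → Fin t)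
  (B : EdgeSubset (completeMultipartite p))
  (uncover : ¬ Cover (removeEdges (completeMultipartite p) B) 4) where

  open Multipartite p
  open Removed B

  grown-unique : ∀ {xs} → Unique xs → Grown (length xs) xs
  grown-unique [] = grown-[]
  grown-unique (x∉ ∷ uniq) = add₀ (λ x∈ → lookup x∉ x∈ refl) (grown-unique uniq)

  -- First the vertices `u` outside the part of `c` are attached. The witness of `common` for `v`
  -- and `u` lies in the part of `v` or is `c`, hence in `S`; it is joined to `u` by `B` unless `u`
  -- is itself in the part of `v`.
  leaf-spanning : (∀ u → ∃ (u ~_)) → ∀ {v c d S} → (∀ x → v ~ x → x ≡ c) →
                  (∀ {u} → p u ≡ p v → u ∈ S) → c ∈ S → Grown d S → n ≤ size B + d
  leaf-spanning neighbours {v} {c} {d} {S} leaf part⊆S c∈S grown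
    with grow-filter (λ u → ¬? (p u Fin.≟ p c)) reach grown
    where
    reach : ∀ {u} → p u ≢ p c → u ∈ S ⊎ ∃ λ y → y ∈ S × u ~ y
    reach {u} pu≢pc with p u Fin.≟ p v
    ... | yes pu≡pv = inj₁ (part⊆S pu≡pv)
    ... | no pu≢pv with common uncover v u
    ...   | z , _ , _ , inj₁ zv , inj₁ zu = contradiction (trans (sym zu) zv) pu≢pv
    ...   | z , _ , _ , inj₁ zv , inj₂ zu = inj₂ (z , part⊆S zv , ~-sym zu)
    ...   | z , _ , _ , inj₂ zv , zu with leaf z (~-sym zv) | zu
    ...     | refl | inj₁ e  = contradiction (sym e) pu≢pc
    ...     | refl | inj₂ cu = inj₂ (c , c∈S , ~-sym cu)
  -- Edges of `B` leave their part, so a neighbour of a remaining vertex was attached in the first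
  -- round. The predicate here is `u ≡ u`, true of all vertices.
  ... | S₁ , grown₁ , S⊆S₁ , out⊆S₁ with grow-filter (λ _ → yes refl) reach′ grown₁
    where
    reach′ : ∀ {u} → u ≡ u → u ∈ S₁ ⊎ ∃ λ y → y ∈ S₁ × u ~ y
    reach′ {u} _ with p u Fin.≟ p c | neighbours u
    ... | no ne | _       = inj₁ (out⊆S₁ ne)
    ... | yes e | w , uw  = inj₂ (w , out⊆S₁ (λ e′ → ~⇒≢part uw (trans e (sym e′))) , uw)
  ...   | S₂ , grown₂ , _ , all = spanning grown₂ λ u → all {u} refl

  -- Apply `common` to `v` and `c`. The witness cannot be a neighbour of `v`, since that would be
  -- `c`; so it is a mate of `v`, and mates of `v` are apart from `c` only through `B`.
  leaf-mate : ∀ {v c} → v ~ c → (∀ x → v ~ x → x ≡ c) → ∃ λ a → a ≢ v × p a ≡ p v × c ~ a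
  leaf-mate {v} {c} vc leaf with common uncover v c
  ... | a , a≢v , _ , inj₁ av , inj₁ ac = contradiction (trans (sym av) ac) (~⇒≢part vc)
  ... | a , a≢v , _ , inj₁ av , inj₂ ac = a , a≢v , av , ~-sym ac
  ... | a , _ , a≢c , inj₂ av , _ = contradiction (leaf a (~-sym av)) a≢c

  -- The vertices of the part of `v` are the roots. As `v` has no neighbour, the witness of `common`
  -- for `v` and `u` is one of them, and `u` hangs on it.
  isolated-bound : ∀ v → (∀ u → ¬ v ~ u) → n ≤ size B + partSize p (p v)
  isolated-bound v isolated with grow-filter (λ _ → yes refl) reach (grown-unique (part-unique (p v)))
    where
    reach : ∀ {u} → u ≡ u → u ∈ part (p v) ⊎ ∃ λ y → y ∈ part (p v) × u ~ y
    reach {u} _ with common uncover v u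
    ... | z , _ , _ , inj₂ zv , _ = contradiction (~-sym zv) (isolated z)
    ... | z , _ , _ , inj₁ zv , inj₁ zu = inj₁ (∈-part⁺ (trans (sym zu) zv))
    ... | z , _ , _ , inj₁ zv , inj₂ zu = inj₂ (z , ∈-part⁺ zv , ~-sym zu)
  ... | S , grown , _ , all = spanning grown λ u → all {u} refl

  -- The mate `a` attaches `c` to the part of `v`, so including `c` does not increase `d`.
  leaf-bound : (∀ u → ∃ (u ~_)) → ∀ v → Leaf v → n ≤ size B + partSize p (p v)
  leaf-bound neighbours v (c , vc , leaf) with leaf-mate vc leaf
  ... | a , _ , av , ca = leaf-spanning neighbours leaf (there ∘ ∈-part⁺) (here refl)
    (add₁ a (λ c∈ → ~⇒≢part vc (sym (∈-part⁻ c∈))) (∈-part⁺ av) ca (grown-unique (part-unique (p v))))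

  branch-bound : (∀ u → 2 ≤ degree u) → n ≤ size B
  branch-bound branch = *-cancelʳ-≤ n (size B) 2
    (subst₂ _≤_ (cong (_* 2) (length-allFin n)) (*-comm 2 (size B))
      (degrees≤2size 2 (Unique.allFin⁺ n) λ {u} _ → branch u))

  positive⇒neighbour : ∀ u → Leaf u ⊎ (2 ≤ degree u) → ∃ (u ~_)
  positive⇒neighbour u pos = decidable-stable (Fin.any? (u ~?_)) λ none → case pos of λ
    { (inj₁ (c , uc , _)) → none (c , uc)
    ; (inj₂ 2≤) → contradiction (≤-trans 2≤ (≤-reflexive (isolated-degree λ v uv → none (v , uv)))) λ ()
    }
    where
    isolated-degree : (∀ v → ¬ u ~ v) → degree u ≡ 0
    isolated-degree isolated = n≤0⇒n≡0 (≤-trans (sum-mono zeros (allFin n))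
      (≤-reflexive (trans (sum-const 0 (allFin n)) (*-zeroʳ (length (allFin n))))))
      where
      zeros : ∀ v → ⟦ mem B u v ⟧ ≤ 0
      zeros v with mem B u v in eq
      ... | true  = contradiction eq (isolated v)
      ... | false = z≤n

  size-bound : ∀ {m} → (∀ j → partSize p j ≤ m) → n ≤ size B + m
  size-bound {m} small with search isolated-leaf-or-branch
  ... | inj₁ (v , isolated) = ≤-trans (isolated-bound v isolated) (+-monoʳ-≤ (size B) (small (p v)))
  ... | inj₂ positive with search positive
  ...   | inj₁ (v , leaf) = ≤-trans (leaf-bound (λ u → positive⇒neighbour u (positive u)) v leaf)
          (+-monoʳ-≤ (size B) (small (p v)))
  ...   | inj₂ branch = ≤-trans (branch-bound branch) (m≤m+n (size B) m)

  -- The leaf v has the single neighbour c and the mates a, b.  If the bound fails, no vertex set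
  -- containing v, c, a, b spans as many edges as a tree; the cases below all contradict this.
  module Triples
    (neighbours : ∀ u → ∃ (u ~_)) (size3 : ∀ j → partSize p j ≡ 3)
    {v c a b : Fin n} (vc : v ~ c) (leaf : ∀ x → v ~ x → x ≡ c) (ca : c ~ a)
    (pa : p a ≡ p v) (pb : p b ≡ p v) (v≢a : v ≢ a) (v≢b : v ≢ b) (a≢b : a ≢ b)
    (third : ∃ λ u → p u ≢ p v × p u ≢ p c) (few : suc (size B) < n) where

    triple : ∀ {x y z} → x ≢ y → x ≢ z → y ≢ z → p y ≡ p x → p z ≡ p x →
             ∀ {u} → p u ≡ p x → u ≡ x ⊎ u ≡ y ⊎ u ≡ z
    triple {x} x≢y x≢z y≢z py pz pu with exhausted ((x≢y ∷ x≢z ∷ []) ∷ (y≢z ∷ []) ∷ [] ∷ [])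
      (λ { (here refl) → refl ; (there (here refl)) → py ; (there (there (here refl))) → pz })
      (≤-reflexive (size3 (p x))) pu
    ... | here e                 = inj₁ e
    ... | there (here e)         = inj₂ (inj₁ e)
    ... | there (there (here e)) = inj₂ (inj₂ e)

    mates-of-v : ∀ {u} → p u ≡ p v → u ≡ v ⊎ u ≡ a ⊎ u ≡ b
    mates-of-v = triple v≢a v≢b a≢b pa pb

    core : List (Fin n)
    core = v ∷ c ∷ a ∷ b ∷ []

    -- With `d = 1`, `leaf-spanning` would extend the set to all vertices and give a bound that
    -- contradicts `few`.
    sparse : ∀ L → ¬ Grown 1 (L ++ core)
    sparse L grown = <⇒≱ few (≤-trans
      (leaf-spanning neighbours leaf part⊆ (∈-++⁺ʳ L (there (here refl))) grown)
      (≤-reflexive (+-comm (size B) 1)))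
      where
      part⊆ : ∀ {u} → p u ≡ p v → u ∈ L ++ core
      part⊆ pu with mates-of-v pu
      ... | inj₁ refl        = ∈-++⁺ʳ L (here refl)
      ... | inj₂ (inj₁ refl) = ∈-++⁺ʳ L (there (there (here refl)))
      ... | inj₂ (inj₂ refl) = ∈-++⁺ʳ L (there (there (there (here refl))))

    -- The tool for all the cases below: two edges at one new vertex lower `d` from 2 to 1.
    crowded : ∀ L {x} y z → y ≢ z → x ∉ L ++ core → y ∈ L ++ core → z ∈ L ++ core →
              x ~ y → x ~ z → ¬ Grown 2 (L ++ core)
    crowded L {x} y z y≢z x∉ y∈ z∈ xy xz grown = sparse (x ∷ L) (add₂ y z y≢z x∉ y∈ z∈ xy xz grown)

    c∈ : ∀ L → c ∈ L ++ core
    c∈ L = ∈-++⁺ʳ L (there (here refl))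

    a∈ : ∀ L → a ∈ L ++ core
    a∈ L = ∈-++⁺ʳ L (there (there (here refl)))

    b∈ : ∀ L → b ∈ L ++ core
    b∈ L = ∈-++⁺ʳ L (there (there (there (here refl))))

    infixr 5 _∷∉_
    _∷∉_ : ∀ {x y : Fin n} {ys} → x ≢ y → x ∉ ys → x ∉ y ∷ ys
    (x≢y ∷∉ x∉) (here e)  = x≢y e
    (x≢y ∷∉ x∉) (there q) = x∉ q

    ≢part⇒≢ : ∀ {x y} → p x ≢ p y → x ≢ y
    ≢part⇒≢ ne refl = ne refl

    ∉core : ∀ {x} → p x ≢ p v → x ≢ c → x ∉ core
    ∉core px x≢c = ≢part⇒≢ px ∷∉ x≢c ∷∉ ≢part⇒≢ (px ∘ λ e → trans e pa) ∷∉ ≢part⇒≢ (px ∘ λ e → trans e pb) ∷∉ λ ()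

    pc≢pv : p c ≢ p v
    pc≢pv = ~⇒≢part vc ∘ sym

    c∉ab : c ∉ a ∷ b ∷ []
    c∉ab = (λ { refl → pc≢pv pa }) ∷∉ (λ { refl → pc≢pv pb }) ∷∉ λ ()

    v∉cab : v ∉ c ∷ a ∷ b ∷ []
    v∉cab = ~⇒≢ vc ∷∉ v≢a ∷∉ v≢b ∷∉ λ ()

    grown-ab : Grown 2 (a ∷ b ∷ [])
    grown-ab = grown-unique ((a≢b ∷ []) ∷ [] ∷ [])

    -- The roots are `a` and `b`; `c` hangs on `a`, and `v` on `c`. One more surplus edge anywhere
    -- gives the contradiction.
    grown-core : Grown 2 core
    grown-core = add₁ c v∉cab (here refl) vc (add₁ a c∉ab (here refl) ca grown-ab)

    -- Otherwise `c` would join the two roots, and `core` would carry three edges on four vertices.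
    ¬bc : ¬ b ~ c
    ¬bc bc = sparse [] (add₁ c v∉cab (here refl) vc
      (add₂ a b a≢b c∉ab (here refl) (there (here refl)) ca (~-sym bc) grown-ab))

    -- The edge to `b` already attaches `w` to `core`, so edges to `a` or `c` would be crowded; `v`
    -- is excluded because its only neighbour is `c`.
    module _ {w} (wb : w ~ b) where

      b-part : p w ≢ p v
      b-part e = ~⇒≢part wb (trans e (sym pb))

      b-≢c : w ≢ c
      b-≢c refl = ¬bc (~-sym wb)

      b-∉core : w ∉ core
      b-∉core = ∉core b-part b-≢c

      b-¬a : ¬ w ~ a
      b-¬a wa = crowded [] a b a≢b b-∉core (a∈ []) (b∈ []) wa wb grown-core

      b-¬c : ¬ w ~ c
      b-¬c wc = crowded [] c b (λ { refl → c∉ab (there (here refl)) }) b-∉core (c∈ []) (b∈ []) wc wb grown-core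

      b-¬v : ¬ w ~ v
      b-¬v wv = b-≢c (leaf w (~-sym wv))

      grown-b : Grown 2 (w ∷ core)
      grown-b = add₁ b b-∉core (b∈ []) wb grown-core

    -- Attach `z` through `b`; then `w` would have the two edges to `z` and `b`.
    b-independent : ∀ {w z} → w ~ b → z ~ b → ¬ w ~ z
    b-independent {w} {z} wb zb wz = crowded (z ∷ []) z b (~⇒≢ zb) (~⇒≢ wz ∷∉ b-∉core wb)
      (here refl) (b∈ (z ∷ [])) wz wb (grown-b zb)

    -- Apply `common` to `w` and `b`. The witness is no mate of `b`, because `w` has no edge to `v`
    -- or `a`, and no second neighbour of `b` joined to `w`, by `b-independent`.
    b-mate : ∀ {w} → w ~ b → ∃ λ z → z ~ b × p z ≡ p w × z ≢ w
    b-mate {w} wb with common uncover w b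
    ... | z , z≢w , z≢b , inj₁ zw , inj₁ zb = contradiction (trans (sym zw) (trans zb pb)) (b-part wb)
    ... | z , z≢w , z≢b , inj₁ zw , inj₂ zb = z , zb , zw , z≢w
    ... | z , z≢w , z≢b , inj₂ zw , inj₂ zb = contradiction (~-sym zw) (b-independent wb zb)
    ... | z , z≢w , z≢b , inj₂ zw , inj₁ zb with mates-of-v (trans zb pb)
    ...   | inj₁ refl        = contradiction (~-sym zw) (b-¬v wb)
    ...   | inj₂ (inj₁ refl) = contradiction (~-sym zw) (b-¬a wb)
    ...   | inj₂ (inj₂ refl) = contradiction refl z≢b

    grown-bb : ∀ {w z} → w ~ b → z ~ b → z ≢ w → Grown 2 (z ∷ w ∷ core)
    grown-bb {w} wb zb z≢w = add₁ b (z≢w ∷∉ b-∉core zb) (b∈ (w ∷ [])) zb (grown-b wb)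

    -- Case A: the part of `c` consists of `c`, `w`, `z`, with `w` and `z` next to `b`. The
    -- contradiction arises in any third part.
    module CaseA {w z} (wb : w ~ b) (zb : z ~ b) (z≢w : z ≢ w) (wc : p w ≡ p c) (zc : p z ≡ p c) where

      L : List (Fin n)
      L = z ∷ w ∷ []

      grown : Grown 2 (L ++ core)
      grown = grown-bb wb zb z≢w

      mates-of-c : ∀ {u} → p u ≡ p c → u ≡ c ⊎ u ≡ w ⊎ u ≡ z
      mates-of-c = triple (b-≢c wb ∘ sym) (b-≢c zb ∘ sym) (z≢w ∘ sym) wc zc

      Far : Fin n → Set
      Far u = p u ≢ p v × p u ≢ p c

      far-∉ : ∀ {u} → Far u → u ∉ L ++ core
      far-∉ (u≢v , u≢c) = ≢part⇒≢ (u≢c ∘ λ e → trans e zc) ∷∉ ≢part⇒≢ (u≢c ∘ λ e → trans e wc) ∷∉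
        ∉core u≢v (≢part⇒≢ u≢c)

      -- As in `leaf-spanning`, the witness for `v` and `u` is `c`, `a` or `b`. So each far vertex
      -- already has one edge into `core`, and a second edge into the grown set is crowded.
      reach : ∀ {u} → Far u → ∃ λ q → q ∈ c ∷ a ∷ b ∷ [] × u ~ q
      reach {u} (u≢v , u≢c) with common uncover v u
      ... | q , q≢v , _ , inj₂ qv , qu with leaf q (~-sym qv) | qu
      ...   | refl | inj₁ e  = contradiction (sym e) u≢c
      ...   | refl | inj₂ cu = c , here refl , ~-sym cu
      reach {u} (u≢v , u≢c) | q , q≢v , _ , inj₁ qv , inj₁ qu = contradiction (trans (sym qu) qv) u≢v
      reach {u} (u≢v , u≢c) | q , q≢v , _ , inj₁ qv , inj₂ qu with mates-of-v qv
      ...   | inj₁ refl        = contradiction refl q≢v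
      ...   | inj₂ (inj₁ refl) = a , there (here refl) , ~-sym qu
      ...   | inj₂ (inj₂ refl) = b , there (there (here refl)) , ~-sym qu

      anchor-≢ : ∀ {x q} → p x ≢ p v → x ≢ c → q ∈ c ∷ a ∷ b ∷ [] → x ≢ q
      anchor-≢ px x≢c q∈ refl = ∉core px x≢c (there q∈)

      far-¬w : ∀ {u} → Far u → ¬ u ~ w
      far-¬w far uw with reach far
      ... | q , q∈ , uq = crowded L w q (anchor-≢ (b-part wb) (b-≢c wb) q∈) (far-∉ far)
        (there (here refl)) (∈-++⁺ʳ L (there q∈)) uw uq grown

      far-¬z : ∀ {u} → Far u → ¬ u ~ z
      far-¬z far uz with reach far
      ... | q , q∈ , uq = crowded L z q (anchor-≢ (b-part zb) (b-≢c zb) q∈) (far-∉ far)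
        (here refl) (∈-++⁺ʳ L (there q∈)) uz uq grown

      far-¬c-mate : ∀ {u x} → Far u → p x ≡ p c → x ≢ c → ¬ u ~ x
      far-¬c-mate far px x≢c with mates-of-c px
      ... | inj₁ e           = contradiction e x≢c
      ... | inj₂ (inj₁ refl) = far-¬w far
      ... | inj₂ (inj₂ refl) = far-¬z far

      -- Given `u ~ a`, every witness of `common` for `u` and `w` clashes with the parts, gives `u`
      -- a second edge into `core`, or needs an edge already excluded.
      far-¬a : ∀ {u} → Far u → ¬ u ~ a
      far-¬a {u} far@(u≢v , u≢c) ua with common uncover u w
      ... | x , _ , _ , inj₁ xu , inj₁ xw = u≢c (trans (sym xu) (trans xw wc))
      ... | x , _ , _ , inj₁ xu , inj₂ xw =
        far-¬w ((λ e → u≢v (trans (sym xu) e)) , (λ e → u≢c (trans (sym xu) e))) xw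
      ... | x , _ , x≢w , inj₂ xu , inj₁ xw with mates-of-c (trans xw wc)
      ...   | inj₁ refl        = crowded L a c (λ { refl → pc≢pv pa }) (far-∉ far) (a∈ L) (c∈ L) ua (~-sym xu) grown
      ...   | inj₂ (inj₁ refl) = x≢w refl
      ...   | inj₂ (inj₂ refl) = far-¬z far (~-sym xu)
      far-¬a {u} far@(u≢v , u≢c) ua | x , _ , _ , inj₂ xu , inj₂ xw with p x Fin.≟ p v
      ...   | no px = far-¬w (px , (λ e → ~⇒≢part xw (trans e (sym wc)))) xw
      ...   | yes px with mates-of-v px
      ...     | inj₁ refl        = b-¬v wb (~-sym xw)
      ...     | inj₂ (inj₁ refl) = b-¬a wb (~-sym xw)
      ...     | inj₂ (inj₂ refl) = crowded L a b a≢b (far-∉ far) (a∈ L) (b∈ L) ua (~-sym xu) grown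

      -- Once `x` is attached through `q`, the vertex `u` has two edges: to `x` and to its own
      -- anchor.
      far-triangle : ∀ {u x q} → Far u → Far x → q ∈ c ∷ a ∷ b ∷ [] → x ~ q → ¬ u ~ x
      far-triangle {u} {x} {q} far-u far-x q∈ xq ux with reach far-u
      ... | r , r∈ , ur = crowded (x ∷ L) x r (anchor-≢ (proj₁ far-x) (≢part⇒≢ (proj₂ far-x)) r∈)
        (~⇒≢ ux ∷∉ far-∉ far-u) (here refl) (∈-++⁺ʳ (x ∷ L) (there r∈)) ux ur
        (add₁ q (far-∉ far-x) (∈-++⁺ʳ L (there q∈)) xq grown)

      -- All ways in which the witness for `u` and `c` could be joined to `u` by `B` are now
      -- excluded, so it is a mate of `u`. The same reasoning gives `mate-at-b`.
      mate-at-c : ∀ {u} → Far u → ∃ λ x → p x ≡ p u × x ≢ u × x ~ c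
      mate-at-c {u} far@(u≢v , u≢c) with common uncover u c
      ... | x , x≢u , x≢c , inj₁ xu , inj₁ xc = contradiction (trans (sym xu) xc) u≢c
      ... | x , x≢u , x≢c , inj₁ xu , inj₂ xc = x , xu , x≢u , xc
      ... | x , x≢u , x≢c , inj₂ xu , inj₁ xc = contradiction (~-sym xu) (far-¬c-mate far xc x≢c)
      ... | x , x≢u , x≢c , inj₂ xu , inj₂ xc with p x Fin.≟ p v
      ...   | no px = contradiction (~-sym xu) (far-triangle far (px , ~⇒≢part xc) (here refl) xc)
      ...   | yes px with mates-of-v px
      ...     | inj₁ refl        = contradiction (cong p (leaf u xu)) u≢c
      ...     | inj₂ (inj₁ refl) = contradiction (~-sym xu) (far-¬a far)
      ...     | inj₂ (inj₂ refl) = contradiction xc ¬bc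

      mate-at-b : ∀ {u} → Far u → ∃ λ x → p x ≡ p u × x ≢ u × x ~ b
      mate-at-b {u} far@(u≢v , u≢c) with common uncover u b
      ... | x , x≢u , x≢b , inj₁ xu , inj₁ xb = contradiction (trans (sym xu) (trans xb pb)) u≢v
      ... | x , x≢u , x≢b , inj₁ xu , inj₂ xb = x , xu , x≢u , xb
      ... | x , x≢u , x≢b , inj₂ xu , inj₂ xb with p x Fin.≟ p c
      ...   | no px  = contradiction (~-sym xu) (far-triangle far (b-part xb , px) (there (there (here refl))) xb)
      ...   | yes px = contradiction (~-sym xu) (far-¬c-mate far px (b-≢c xb))
      mate-at-b {u} far@(u≢v , u≢c) | x , x≢u , x≢b , inj₂ xu , inj₁ xb with mates-of-v (trans xb pb)
      ...   | inj₁ refl        = contradiction (cong p (leaf u xu)) u≢c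
      ...   | inj₂ (inj₁ refl) = contradiction (~-sym xu) (far-¬a far)
      ...   | inj₂ (inj₂ refl) = contradiction refl x≢b

      -- Every part away from v and c has two vertices next to b and two next to c, but only three vertices.
      ¬far : ∀ {u} → ¬ Far u
      ¬far {u} far with mate-at-c far | mate-at-b far
      ...   | x , xu , _ , xc | y , yu , _ , yb
        with mate-at-c {x} (subst (λ j → j ≢ p v × j ≢ p c) (sym xu) far)
           | mate-at-b {y} (subst (λ j → j ≢ p v × j ≢ p c) (sym yu) far)
      ...     | x′ , x′x , x′≢x , x′c | y′ , y′y , y′≢y , y′b =
        <⇒≱ (n<1+n 3) (subst (4 ≤_) (size3 (p u)) (length-unique-⊆ {xs = x ∷ x′ ∷ y ∷ y′ ∷ []}
          (((x′≢x ∘ sym) ∷ apart xc yb ∷ apart xc y′b ∷ []) ∷ (apart x′c yb ∷ apart x′c y′b ∷ []) ∷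
            ((y′≢y ∘ sym) ∷ []) ∷ [] ∷ [])
          λ { (here refl) → ∈-part⁺ xu
            ; (there (here refl)) → ∈-part⁺ (trans x′x xu)
            ; (there (there (here refl))) → ∈-part⁺ yu
            ; (there (there (there (here refl)))) → ∈-part⁺ (trans y′y yu) }))
        where
        apart : ∀ {x y} → x ~ c → y ~ b → x ≢ y
        apart xc yb refl = b-¬c yb xc

      absurd : ⊥
      absurd = ¬far (proj₂ third)

    b-part≢c : ∀ {w} → w ~ b → p w ≢ p c
    b-part≢c wb wc with b-mate wb
    ... | z , zb , zw , z≢w = CaseA.absurd wb zb z≢w wc (trans zw wc)

    -- Case B: the part of `w` is not that of `c`, and its third vertex `y` is next to `c`. Then `y`
    -- is next to a mate `d` of `c`, and no witness of `common` is left for `d` and `b`.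
    module CaseB {w y z} (wb : w ~ b) (yw : p y ≡ p w) (yc : y ~ c)
                 (zb : z ~ b) (zw : p z ≡ p w) (z≢w : z ≢ w) where

      y≢w : y ≢ w
      y≢w refl = b-¬c wb yc

      y≢z : y ≢ z
      y≢z refl = b-¬c zb yc

      y∉ : y ∉ z ∷ w ∷ core
      y∉ = y≢z ∷∉ y≢w ∷∉ ∉core (b-part wb ∘ trans (sym yw)) (~⇒≢ yc)

      L : List (Fin n)
      L = y ∷ z ∷ w ∷ []

      grown : Grown 2 (L ++ core)
      grown = add₁ c y∉ (c∈ (z ∷ w ∷ [])) yc (grown-bb wb zb z≢w)

      c-mate-at-y : ∃ λ d → p d ≡ p c × d ≢ c × d ~ y
      c-mate-at-y with common uncover c y
      ... | x , x≢c , x≢y , inj₁ xc , inj₁ xy = contradiction (trans (sym yw) (trans (sym xy) xc)) (b-part≢c wb)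
      ... | x , x≢c , x≢y , inj₁ xc , inj₂ xy = x , xc , x≢c , xy
      ... | x , x≢c , x≢y , inj₂ xc , inj₁ xy
        with triple (z≢w ∘ sym) (y≢w ∘ sym) (y≢z ∘ sym) zw yw (trans xy yw)
      ...   | inj₁ refl        = contradiction xc (b-¬c wb)
      ...   | inj₂ (inj₁ refl) = contradiction xc (b-¬c zb)
      ...   | inj₂ (inj₂ refl) = contradiction refl x≢y
      c-mate-at-y | x , x≢c , x≢y , inj₂ xc , inj₂ xy with p x Fin.≟ p v
      ...   | no px = contradiction grown (crowded L y c (~⇒≢ yc)
              (x≢y ∷∉ ≢part⇒≢ (λ e → ~⇒≢part xy (trans e (trans zw (sym yw)))) ∷∉
                ≢part⇒≢ (λ e → ~⇒≢part xy (trans e (sym yw))) ∷∉ ∉core px x≢c)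
              (here refl) (c∈ L) xy xc)
      ...   | yes px with mates-of-v px
      ...     | inj₁ refl        = contradiction (leaf y xy) (~⇒≢ yc)
      ...     | inj₂ (inj₁ refl) = contradiction (grown-bb wb zb z≢w) (crowded (z ∷ w ∷ []) a c
                (λ { refl → pc≢pv pa }) y∉ (a∈ (z ∷ w ∷ [])) (c∈ (z ∷ w ∷ [])) (~-sym xy) yc)
      ...     | inj₂ (inj₂ refl) = contradiction xc ¬bc

      absurd : ⊥
      absurd with c-mate-at-y
      ... | d , dc , d≢c , dy with common uncover d b
      ...   | x , x≢d , x≢b , inj₁ xd , inj₁ xb = pc≢pv (trans (sym dc) (trans (sym xd) (trans xb pb)))
      ...   | x , x≢d , x≢b , inj₁ xd , inj₂ xb = b-part≢c xb (trans xd dc)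
      ...   | x , x≢d , x≢b , inj₂ xd , xb = next xb
        where
        d≢part-w : p d ≢ p w
        d≢part-w e = b-part≢c wb (trans (sym e) dc)
        d∉ : d ∉ L ++ core
        d∉ = ~⇒≢ dy ∷∉ ≢part⇒≢ (d≢part-w ∘ λ e → trans e zw) ∷∉ ≢part⇒≢ d≢part-w ∷∉
          ∉core (pc≢pv ∘ trans (sym dc)) d≢c
        next : ¬ Apart x b
        next (inj₁ xb) with mates-of-v (trans xb pb)
        ... | inj₁ refl        = d≢c (leaf d xd)
        ... | inj₂ (inj₁ refl) = crowded L y a (λ { refl → b-part wb (trans (sym yw) pa) }) d∉
              (here refl) (a∈ L) dy (~-sym xd) grown
        ... | inj₂ (inj₂ refl) = x≢b refl
        next (inj₂ xb) with x Fin.≟ w | x Fin.≟ z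
        ... | yes refl | _ = crowded L y w y≢w d∉ (here refl) (there (there (here refl))) dy (~-sym xd) grown
        ... | no _ | yes refl = crowded L y z y≢z d∉ (here refl) (there (here refl)) dy (~-sym xd) grown
        -- First `d` is attached through `y`; then `x` has the two edges to `d` and `b`.
        ... | no x≢w | no x≢z = crowded (d ∷ L) d b (λ { refl → pc≢pv (trans (sym dc) pb) })
          (x≢d ∷∉ (λ { refl → b-¬c xb yc }) ∷∉ x≢z ∷∉ x≢w ∷∉ b-∉core xb) (here refl) (b∈ (d ∷ L)) xd xb
          (add₁ y d∉ (here refl) dy grown)

    b-part-¬c : ∀ {w y} → w ~ b → p y ≡ p w → ¬ y ~ c
    b-part-¬c wb yw yc with b-mate wb
    ... | z , zb , zw , z≢w = CaseB.absurd wb yw yc zb zw z≢w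

    -- Case B excludes mates of `w` as witnesses for `w` and `c`, and a vertex joined to both would
    -- make `w` crowded. A mate of `c` remains.
    b-at-c-mate : ∀ {w} → w ~ b → ∃ λ d → p d ≡ p c × d ≢ c × d ~ w
    b-at-c-mate {w} wb with common uncover w c
    ... | x , x≢w , x≢c , inj₁ xw , inj₁ xc = contradiction (trans (sym xw) xc) (b-part≢c wb)
    ... | x , x≢w , x≢c , inj₁ xw , inj₂ xc = contradiction xc (b-part-¬c wb xw)
    ... | x , x≢w , x≢c , inj₂ xw , inj₁ xc = x , xc , x≢c , xw
    ... | x , x≢w , x≢c , inj₂ xw , inj₂ xc with p x Fin.≟ p v
    ...   | no px = contradiction (add₁ c (∉core px x≢c) (c∈ []) xc grown-core)
            (crowded (x ∷ []) x b (λ { refl → px pb }) (x≢w ∘ sym ∷∉ b-∉core wb) (here refl) (b∈ (x ∷ []))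
              (~-sym xw) wb)
    ...   | yes px with mates-of-v px
    ...     | inj₁ refl        = contradiction (~-sym xw) (b-¬v wb)
    ...     | inj₂ (inj₁ refl) = contradiction (~-sym xw) (b-¬a wb)
    ...     | inj₂ (inj₂ refl) = contradiction xc ¬bc

    -- Case C, the last configuration: `w`, `z` are mates next to `b`, and the mates `d`, `e` of `c`
    -- are next to `w` and `z` respectively.
    module CaseC {w z d e} (wb : w ~ b) (zb : z ~ b) (zw : p z ≡ p w) (z≢w : z ≢ w)
                 (dc : p d ≡ p c) (d≢c : d ≢ c) (dw : d ~ w)
                 (ec : p e ≡ p c) (e≢c : e ≢ c) (ez : e ~ z) where

      c-mate∉ : ∀ {x} → p x ≡ p c → x ≢ c → x ∉ z ∷ w ∷ core
      c-mate∉ xc x≢c = ≢part⇒≢ (λ q → b-part≢c zb (trans (sym q) xc)) ∷∉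
        ≢part⇒≢ (λ q → b-part≢c wb (trans (sym q) xc)) ∷∉ ∉core (pc≢pv ∘ trans (sym xc)) x≢c

      ¬both : ∀ {x} → p x ≡ p c → x ≢ c → x ~ w → ¬ x ~ z
      ¬both xc x≢c xw xz = crowded (z ∷ w ∷ []) z w z≢w (c-mate∉ xc x≢c) (here refl) (there (here refl))
        xz xw (grown-bb wb zb z≢w)

      e≢d : e ≢ d
      e≢d refl = ¬both dc d≢c dw ez

      L : List (Fin n)
      L = e ∷ d ∷ z ∷ w ∷ []

      grown : Grown 2 (L ++ core)
      grown = add₁ z (e≢d ∷∉ c-mate∉ ec e≢c) (there (here refl)) ez
        (add₁ w (c-mate∉ dc d≢c) (there (here refl)) dw (grown-bb wb zb z≢w))

      -- Apply `common` to `d` and `w`. Mates of `d` and vertices joined to both are excluded by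
      -- earlier cases or by crowding, so only the third vertex in the part of `w` is left.
      third-mate : ∃ λ y → p y ≡ p w × y ≢ w × y ≢ z × y ~ d
      third-mate with common uncover d w
      ... | x , x≢d , x≢w , inj₁ xd , inj₁ xw = contradiction (trans (sym xw) (trans xd dc)) (b-part≢c wb)
      ... | x , x≢d , x≢w , inj₂ xd , inj₁ xw with x Fin.≟ z
      ...   | yes refl = contradiction (~-sym xd) (¬both dc d≢c dw)
      ...   | no x≢z   = x , xw , x≢w , x≢z , xd
      third-mate | x , x≢d , x≢w , inj₁ xd , inj₂ xw
        with triple (d≢c ∘ sym) (e≢c ∘ sym) (e≢d ∘ sym) dc ec (trans xd dc)
      ...   | inj₁ refl        = contradiction (~-sym xw) (b-¬c wb)
      ...   | inj₂ (inj₁ refl) = contradiction refl x≢d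
      ...   | inj₂ (inj₂ refl) = contradiction ez (¬both ec e≢c xw)
      third-mate | x , x≢d , x≢w , inj₂ xd , inj₂ xw with p x Fin.≟ p v
      ...   | no px = contradiction grown (crowded L d w (~⇒≢ dw)
              (≢part⇒≢ (λ q → ~⇒≢part xd (trans q (trans ec (sym dc)))) ∷∉ x≢d ∷∉
                ≢part⇒≢ (λ q → ~⇒≢part xw (trans q zw)) ∷∉ x≢w ∷∉
                ∉core px (≢part⇒≢ λ q → ~⇒≢part xd (trans q (sym dc))))
              (there (here refl)) (there (there (there (here refl)))) xd xw)
      ...   | yes px with mates-of-v px
      ...     | inj₁ refl        = contradiction (leaf d xd) d≢c
      ...     | inj₂ (inj₁ refl) = contradiction (~-sym xw) (b-¬a wb)
      ...     | inj₂ (inj₂ refl) = contradiction dc (b-part≢c (~-sym xd))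

    absurd : ⊥
    absurd with neighbours b
    ... | w , bw with ~-sym bw
    ...   | wb with b-mate wb
    ...     | z , zb , zw , z≢w with b-at-c-mate wb | b-at-c-mate zb
    ...       | d , dc , d≢c , dw | e , ec , e≢c , ez =
      crowded L d e (e≢d ∘ sym)
        (≢part⇒≢ (λ q → b-part≢c wb (trans (sym yw) (trans q ec))) ∷∉ ~⇒≢ yd ∷∉ y≢z ∷∉ y≢w ∷∉
          ∉core (b-part wb ∘ trans (sym yw)) (≢part⇒≢ λ q → b-part≢c wb (trans (sym yw) q)))
        (there (here refl)) (here refl) yd ye grown
      where
      open CaseC wb zb zw z≢w dc d≢c dw ec e≢c ez
      open Σ third-mate renaming (proj₁ to y; proj₂ to y-props)
      yw : p y ≡ p w
      yw = proj₁ y-props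
      y≢w : y ≢ w
      y≢w = proj₁ (proj₂ y-props)
      y≢z : y ≢ z
      y≢z = proj₁ (proj₂ (proj₂ y-props))
      yd : y ~ d
      yd = proj₂ (proj₂ (proj₂ y-props))
      ye : y ~ e
      -- Case C with `w`, `z` and `d`, `e` exchanged yields the same third vertex, since the part
      -- has size 3. So `y` has two edges, to `d` and `e`.
      ye with CaseC.third-mate zb wb (sym zw) (z≢w ∘ sym) ec e≢c ez dc d≢c dw
      ... | y′ , y′z , y′≢z , y′≢w , y′e
        with triple (z≢w ∘ sym) (y≢w ∘ sym) (y≢z ∘ sym) zw yw (trans y′z zw)
      ...   | inj₁ refl        = contradiction refl y′≢w
      ...   | inj₂ (inj₁ refl) = contradiction refl y′≢z
      ...   | inj₂ (inj₂ refl) = y′e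

  triple-bound : (∀ u → ∃ (u ~_)) → (∀ j → partSize p j ≡ 3) →
                 (∀ j k → ∃ λ u → p u ≢ j × p u ≢ k) → n ≤ suc (size B)
  triple-bound neighbours size3 third with search isolated-leaf-or-branch
  ... | inj₁ (v , isolated) = contradiction (proj₂ (neighbours v)) (isolated _)
  ... | inj₂ positive with search positive
  ...   | inj₂ branch = m≤n⇒m≤1+n (branch-bound branch)
  ...   | inj₁ (v , c , vc , leaf) with leaf-mate vc leaf
  ...     | a , a≢v , pa , ca with larger-part (p v) (v ∷ a ∷ []) (≤-reflexive (sym (size3 (p v))))
  ...       | b , pb , b∉ = ≮⇒≥ λ few → Triples.absurd neighbours size3 vc leaf ca pa pb
              (a≢v ∘ sym) (λ e → b∉ (here (sym e))) (λ e → b∉ (there (here (sym e)))) (third (p v) (p c)) few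

-- Edge sets that raise the Roman domination number

module _ {n t} (p : Fin n → Fin t) (parts≥ : ∀ j → 1 ≤ partSize p j) where

  open Multipartite p

  representative : ∀ j → ∃ λ u → p u ≡ j
  representative j with larger-part j [] (parts≥ j)
  ... | u , pu , _ = u , pu

module _ {n t} (p : Fin n → Fin t) {μ} (parts≥μ : ∀ j → μ ≤ partSize p j) where

  open Multipartite p
  open Removed

  -- The part of `v` comes for free; a `B`-neighbour lies in another part and adds one.
  nonNeighbours : ∀ B {k} v → k ≤ partSize p (p v) ⊎ (k ≤ suc (partSize p (p v)) × ∃ (_~_ B v)) →
                  NonNeighbours (GB B) k v
  nonNeighbours B v (inj₁ k≤) = part (p v) , part-unique (p v) , k≤ ,
    λ x∈ → apart⇒nonadj B (inj₁ (∈-part⁻ x∈))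
  nonNeighbours B v (inj₂ (k≤ , w , vw)) = w ∷ part (p v) ,
    All.tabulate (λ x∈ w≡x → ~⇒≢part B vw (sym (trans (cong p w≡x) (∈-part⁻ x∈)))) ∷ part-unique (p v) , k≤ ,
    λ { (here refl) → apart⇒nonadj B (inj₂ (~-sym B vw)) ; (there x∈) → apart⇒nonadj B (inj₁ (∈-part⁻ x∈)) }

  -- The threshold is `μ + 1`. Parts above the minimum size supply enough non-neighbours by
  -- themselves, minimum ones with the help of `B`; pairs of label 2 are still too expensive.
  covering-raises : ∀ B → suc μ ≤ 3 → suc μ < n → ∀ {u} → partSize p (p u) ≡ μ →
                    (∀ v → partSize p (p v) ≡ μ → ∃ (_~_ B v)) → RaisesRDN G B
  covering-raises B μ<3 μ<n {u} minimal covered = raises {B = B}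
    (subst (Cover G ∘ suc) minimal (part-cover G u λ x px → adj⁺ px))
    (uncoverable (GB B) (m≤n⇒m≤1+n μ<3) μ<n many λ e → contradiction (subst (_≤ 3) e μ<3) (<⇒≱ (n<1+n 3)))
    where
    many : ∀ v → NonNeighbours (GB B) (suc μ) v
    many v with m≤n⇒m<n∨m≡n (parts≥μ (p v))
    ... | inj₁ μ<  = nonNeighbours B v (inj₁ μ<)
    ... | inj₂ μ≡  = nonNeighbours B v (inj₂ (s≤s (parts≥μ (p v)) , covered v (sym μ≡)))

  raised-uncoverable : ∀ B → μ ≤ 3 → μ < n → RaisesRDN G B → ¬ Cover (GB B) (suc μ)
  raised-uncoverable B μ≤3 μ<n raise = raised {B = B} raise (G-uncoverable μ≤3 μ<n parts≥μ)

  raised-covers : ∀ B → μ ≤ 3 → μ < n → RaisesRDN G B → ∀ u → partSize p (p u) ≡ μ → ∃ (_~_ B u)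
  raised-covers B μ≤3 μ<n raise u refl = neighbour B u (raised-uncoverable B μ≤3 μ<n raise)

  -- The threshold is 4. In `G − B` the vertex `v₀` is isolated, so a dominating pair must contain
  -- it; its partner `w` then misses a vertex in its own part, which has at least three.
  star-raises : ∀ B {v₀ w₀} → 3 ≤ μ → 4 < n → p v₀ ≢ p w₀ → (∀ x → p v₀ ≢ p x → _~_ B v₀ x) →
                (∀ v → 4 ≤ partSize p (p v) ⊎ ∃ (_~_ B v)) → RaisesRDN G B
  star-raises B {v₀} 3≤μ 4<n v₀w₀ star big-or-covered = raises {B = B} (two-part-cover v₀w₀)
    (uncoverable (GB B) ≤-refl 4<n
      (λ v → nonNeighbours B v (Sum.map₂ (s≤s (≤-trans 3≤μ (parts≥μ (p v))) ,_) (big-or-covered v)))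
      λ _ → pair)
    where
    isolated : ∀ x → Apart B v₀ x
    isolated x with p v₀ Fin.≟ p x
    ... | yes e = inj₁ e
    ... | no ne = inj₂ (star x ne)
    apart-sym : ∀ {x y} → Apart B x y → Apart B y x
    apart-sym (inj₁ e)  = inj₁ (sym e)
    apart-sym (inj₂ xy) = inj₂ (~-sym B xy)
    mate : ∀ w → ∃ λ u → u ≢ v₀ × u ≢ w × Apart B u v₀ × Apart B u w
    mate w with larger-part (p w) (v₀ ∷ w ∷ []) (≤-trans 3≤μ (parts≥μ (p w)))
    ... | u , pu , u∉ = u , u∉ ∘ here , u∉ ∘ there ∘ here , apart-sym (isolated u) , inj₁ pu
    pair : ∀ v w → ∃ λ u → u ≢ v × u ≢ w × adj (GB B) u v ≢ true × adj (GB B) u w ≢ true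
    pair v w with v Fin.≟ v₀ | w Fin.≟ v₀
    ... | yes refl | _ with mate w
    ...   | u , u≢v , u≢w , uv , uw = u , u≢v , u≢w , apart⇒nonadj B uv , apart⇒nonadj B uw
    pair v w | no _ | yes refl with mate v
    ...   | u , u≢w , u≢v , uw , uv = u , u≢v , u≢w , apart⇒nonadj B uv , apart⇒nonadj B uw
    pair v w | no v≢ | no w≢ = v₀ , v≢ ∘ sym , w≢ ∘ sym , apart⇒nonadj B (isolated v) , apart⇒nonadj B (isolated w)

-- An upper bound on `size B` suffices: minimality applied to `B` itself gives the reverse
-- inequality.
bondage-number : ∀ {n b} {G : Graph n} (B : EdgeSubset G) → RaisesRDN G B → size B ≤ b →
                 (∀ B′ → RaisesRDN G B′ → b ≤ size B′) → IsRomanBondageNumber G b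
bondage-number B raise size≤ minimal = (B , raise , ≤-antisym size≤ (minimal B raise)) , minimal

half : ∀ j → ∃ λ k → j ≡ k + k ⊎ j ≡ suc (k + k)
half zero = 0 , inj₁ refl
half (suc zero) = 0 , inj₂ refl
half (suc (suc j)) with half j
... | k , inj₁ e = suc k , inj₁ (cong suc (trans (cong suc e) (sym (+-suc k k))))
... | k , inj₂ e = suc k , inj₂ (cong suc (cong suc (trans e (sym (+-suc k k)))))

module Cyclic {s} (M : ℕ) (M≤ : M ≤ suc s) where

  -- Reduction modulo `M`, needed only for arguments up to `M`; so everything from `M` on may go to
  -- 0.
  wrap : ℕ → Fin (suc s)
  wrap k with k <? M
  ... | yes k<M = Fin.fromℕ< (≤-trans k<M M≤)
  ... | no _    = zero

  toℕ-wrap : ∀ {k} → k < M → toℕ (wrap k) ≡ k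
  toℕ-wrap {k} k<M with k <? M
  ... | yes _ = Fin.toℕ-fromℕ< _
  ... | no ¬< = contradiction k<M ¬<

  wrap-≥ : ∀ {k} → M ≤ k → wrap k ≡ zero
  wrap-≥ {k} M≤k with k <? M
  ... | yes k<M = contradiction M≤k (<⇒≱ k<M)
  ... | no _    = refl

  wrap-toℕ : ∀ {j} → toℕ j < M → wrap (toℕ j) ≡ j
  wrap-toℕ j<M = Fin.toℕ-injective (toℕ-wrap j<M)

  wrap-≢ : 2 ≤ M → ∀ {k} → k < M → wrap k ≢ wrap (suc k)
  wrap-≢ 2≤M {k} k<M e = <⇒≱ 2≤M (≤-trans M≤1+k (s≤s (≤-reflexive
    (trans (sym (toℕ-wrap k<M)) (cong toℕ (trans e (wrap-≥ M≤1+k)))))))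
    where
    M≤1+k : M ≤ suc k
    M≤1+k = ≮⇒≥ λ k+1<M → 1+n≢n (sym (trans (sym (toℕ-wrap k<M)) (trans (cong toℕ e) (toℕ-wrap k+1<M))))

  predecessor : 1 ≤ M → ∀ {j} → toℕ j < M → ∃ λ k → k < M × wrap (suc k) ≡ j
  predecessor (s≤s {n = M′} _) {zero} _ = M′ , ≤-refl , wrap-≥ ≤-refl
  predecessor _ {suc j} j<M = toℕ j , <⇒≤ j<M , wrap-toℕ j<M

-- The five cases of the formula

module Bondage {s n} (p : Fin n → Fin (suc (suc s)))
  (monotone : ∀ j k → toℕ j ≤ toℕ k → partSize p j ≤ partSize p k)
  (nonempty : ∀ j → 1 ≤ partSize p j)
  {i} (1≤i : 1 ≤ i) (i≤t : i ≤ suc (suc s))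
  (minimal : ∀ j → toℕ j < i → partSize p j ≡ partSize p zero)
  (larger : ∀ j → i ≤ toℕ j → partSize p zero < partSize p j) where

  open Multipartite p
  open Removed

  0F 1F last : Fin (suc (suc s))
  0F = zero
  1F = suc zero
  last = fromℕ (suc s)

  parts≥ : ∀ j → partSize p 0F ≤ partSize p j
  parts≥ j = monotone 0F j z≤n

  parts≤ : ∀ j → partSize p j ≤ partSize p last
  parts≤ j = monotone j last (subst (toℕ j ≤_) (sym (Fin.toℕ-fromℕ (suc s))) (≤-pred (Fin.toℕ<n j)))

  n≥ : partSize p 0F + partSize p last ≤ n
  n≥ = two-parts≤n λ ()

  minimal⇒<i : ∀ {j} → partSize p j ≡ partSize p 0F → toℕ j < i
  minimal⇒<i {j} e = ≰⇒> λ i≤j → <-irrefl (sym e) (larger j i≤j)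

  x : Fin (suc (suc s)) → Fin n
  x j = proj₁ (representative p nonempty j)

  px : ∀ j → p (x j) ≡ j
  px j = proj₂ (representative p nonempty j)

  x-injective : ∀ {j k} → x j ≡ x k → j ≡ k
  x-injective e = trans (sym (px _)) (trans (cong p e) (px _))

  minimal-part : ∀ {μ} → partSize p 0F ≡ μ → partSize p (p (x 0F)) ≡ μ
  minimal-part e = trans (cong (partSize p) (px 0F)) e

  among-first : Fin i → Fin (suc (suc s))
  among-first j = Fin.inject≤ j i≤t

  among-first-size : ∀ {μ} → partSize p 0F ≡ μ → ∀ {u} j → p u ≡ among-first j → partSize p (p u) ≡ μ
  among-first-size e j pu = trans (cong (partSize p) pu)
    (trans (minimal (among-first j) (subst (_< i) (sym (Fin.toℕ-inject≤ j i≤t)) (Fin.toℕ<n j))) e)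

  xs : List (Fin n)
  xs = tabulate (x ∘ among-first)

  xs-unique : Unique xs
  xs-unique = Unique.tabulate⁺ (Fin.inject≤-injective i≤t i≤t _ _ ∘ x-injective)

  -- Parts `2k` and `2k + 1` are joined. For odd `i` the last singleton is joined to the next part,
  -- or to part 0 if all parts are singletons. Conversely, an edge covers at most two of the `i`
  -- singletons.
  size-1 : partSize p 0F ≡ 1 → 3 ≤ n → IsRomanBondageNumber G ⌈ i /2⌉
  size-1 m≡1 3≤n = bondage-number (arcSet G arcs)
    (covering-raises p nonempty (arcSet G arcs) (s≤s (s≤s z≤n)) 3≤n (minimal-part m≡1) covered)
    (≤-trans (size-arcSet G arcs) (≤-reflexive (trans (length-map arc (upTo ⌈ i /2⌉)) (length-upTo ⌈ i /2⌉))))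
    lower-bound
    where
    open Cyclic {suc s} (suc (suc s)) ≤-refl
    arc : ℕ → Fin n × Fin n
    arc k = x (wrap (k + k)) , x (wrap (suc (k + k)))
    arcs = map arc (upTo ⌈ i /2⌉)
    B = arcSet G arcs
    arc-mem : ∀ {k} → k + k < i → _~_ B (x (wrap (k + k))) (x (wrap (suc (k + k))))
    arc-mem {k} 2k<i = arcSet-mem G (∈-map⁺ arc (∈-upTo⁺ k<)) (adj⁺ λ e →
      wrap-≢ (s≤s (s≤s z≤n)) (≤-trans 2k<i i≤t) (trans (sym (px _)) (trans e (px _))))
      where
      k< : k < ⌈ i /2⌉
      -- `⌈ i /2⌉` unfolds to the floor of `(i + 1) / 2`, and `2k + 2 ≤ i + 1`.
      k< = ≤-trans (≤-reflexive (sym (cong suc (sym (n≡⌊n+n/2⌋ k))))) (⌊n/2⌋-mono (s≤s 2k<i))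
    only : ∀ v → partSize p (p v) ≡ 1 → v ≡ x (p v)
    only v e with exhausted {p v} {x (p v) ∷ []} ([] ∷ []) (λ { (here refl) → px _ }) (≤-reflexive e) refl
    ... | here q = q
    covered : ∀ v → partSize p (p v) ≡ 1 → ∃ (_~_ B v)
    covered v e = go (half (toℕ (p v)))
      where
      j<i : toℕ (p v) < i
      j<i = minimal⇒<i (trans e (sym m≡1))
      at : ∀ {k} → toℕ (p v) ≡ k → x (wrap k) ≡ v
      at refl = trans (cong x (wrap-toℕ (Fin.toℕ<n (p v)))) (sym (only v e))
      go : (∃ λ k → toℕ (p v) ≡ k + k ⊎ toℕ (p v) ≡ suc (k + k)) → ∃ (_~_ B v)
      go (k , inj₁ q) = _ , subst (λ u → _~_ B u (x (wrap (suc (k + k))))) (at q) (arc-mem {k} (subst (_< i) q j<i))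
      go (k , inj₂ q) = _ , subst (λ u → _~_ B u (x (wrap (k + k)))) (at q)
        (~-sym B (arc-mem {k} (<⇒≤ (subst (_< i) q j<i))))
    lower-bound : ∀ B′ → RaisesRDN G B′ → ⌈ i /2⌉ ≤ size B′
    lower-bound B′ raise = ≤-trans (⌈n/2⌉-mono i≤2size)
      (≤-reflexive (trans (cong ⌈_/2⌉ (cong (size B′ +_) (+-identityʳ (size B′)))) (sym (n≡⌈n+n/2⌉ (size B′)))))
      where
      i≤2size : i ≤ 2 * size B′
      i≤2size = subst (_≤ 2 * size B′) (length-tabulate (x ∘ among-first)) (covered≤2size B′ xs-unique neighbours)
        where
        neighbours : ∀ {u} → u ∈ xs → ∃ (_~_ B′ u)
        neighbours u∈ with ∈-tabulate⁻ {f = x ∘ among-first} u∈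
        ... | j , refl = raised-covers p nonempty B′ (s≤s z≤n) (<⇒≤ 3≤n) raise _
                (among-first-size m≡1 j (px _))

  module Size2 (m≡2 : partSize p 0F ≡ 2) where

    parts≥2 : ∀ j → 2 ≤ partSize p j
    parts≥2 j = subst (_≤ partSize p j) m≡2 (parts≥ j)

    4≤n : 4 ≤ n
    4≤n = ≤-trans (+-mono-≤ (parts≥2 0F) (parts≥2 last)) n≥

    second : ∀ j → ∃ λ u → p u ≡ j × u ∉ x j ∷ []
    second j = larger-part j (x j ∷ []) (parts≥2 j)

    y : Fin (suc (suc s)) → Fin n
    y j = proj₁ (second j)

    py : ∀ j → p (y j) ≡ j
    py j = proj₁ (proj₂ (second j))

    x≢y : ∀ {j k} → x j ≢ y k
    x≢y {j} {k} e with trans (sym (px j)) (trans (cong p e) (py k))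
    ... | refl = proj₂ (proj₂ (second j)) (here (sym e))

    only : ∀ v → partSize p (p v) ≡ 2 → v ≡ x (p v) ⊎ v ≡ y (p v)
    only v e with exhausted {p v} {x (p v) ∷ y (p v) ∷ []} ((x≢y ∷ []) ∷ [] ∷ [])
      (λ { (here refl) → px _ ; (there (here refl)) → py _ }) (≤-reflexive e) refl
    ... | here q         = inj₁ q
    ... | there (here q) = inj₂ q

    covers : ∀ B′ → RaisesRDN G B′ → ∀ u → partSize p (p u) ≡ 2 → ∃ (_~_ B′ u)
    covers B′ = raised-covers p parts≥2 B′ (s≤s (s≤s z≤n)) (<⇒≤ 4≤n)

    -- The two vertices of the smallest part are not adjacent, so no single edge covers both.
    single-part : i ≡ 1 → IsRomanBondageNumber G 2
    single-part i≡1 = bondage-number B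
      (covering-raises p parts≥2 B ≤-refl 4≤n (minimal-part m≡2) covered) (size-arcSet G arcs) lower-bound
      where
      arcs = (x 0F , x 1F) ∷ (y 0F , x 1F) ∷ []
      B = arcSet G arcs
      covered : ∀ v → partSize p (p v) ≡ 2 → ∃ (_~_ B v)
      covered v e with Fin.toℕ-injective {i = p v} {j = 0F}
        (n≤0⇒n≡0 (≤-pred (subst (toℕ (p v) <_) i≡1 (minimal⇒<i (trans e (sym m≡2))))))
      ... | pv≡0 with only v e
      ...   | inj₁ q = x 1F , arcSet-mem G (here (cong (_, x 1F) (trans q (cong x pv≡0))))
              (adj⁺ λ e → case trans (sym pv≡0) (trans e (px 1F)) of λ ())
      ...   | inj₂ q = x 1F , arcSet-mem G (there (here (cong (_, x 1F) (trans q (cong y pv≡0)))))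
              (adj⁺ λ e → case trans (sym pv≡0) (trans e (px 1F)) of λ ())
      lower-bound : ∀ B′ → RaisesRDN G B′ → 2 ≤ size B′
      lower-bound B′ raise = two-edges B′ x≢y (λ xy → ~⇒≢part B′ xy (trans (px 0F) (sym (py 0F))))
        (covers B′ raise (x 0F) (minimal-part m≡2))
        (covers B′ raise (y 0F) (trans (cong (partSize p) (py 0F)) m≡2))

    -- Joining each `x` to the `y` of the cyclically next smallest part gives a perfect matching of
    -- the `2 * i` vertices to be covered; `2 ≤ i` keeps the two ends in different parts.
    many-parts : 2 ≤ i → IsRomanBondageNumber G i
    many-parts 2≤i = bondage-number B
      (covering-raises p parts≥2 B ≤-refl 4≤n (minimal-part m≡2) covered)
      (≤-trans (size-arcSet G arcs) (≤-reflexive (trans (length-map arc (upTo i)) (length-upTo i))))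
      lower-bound
      where
      open Cyclic {suc s} i i≤t
      arc : ℕ → Fin n × Fin n
      arc k = x (wrap k) , y (wrap (suc k))
      arcs = map arc (upTo i)
      B = arcSet G arcs
      arc-mem : ∀ {k} → k < i → _~_ B (x (wrap k)) (y (wrap (suc k)))
      arc-mem k<i = arcSet-mem G (∈-map⁺ arc (∈-upTo⁺ k<i))
        (adj⁺ λ e → wrap-≢ 2≤i k<i (trans (sym (px _)) (trans e (py _))))
      covered : ∀ v → partSize p (p v) ≡ 2 → ∃ (_~_ B v)
      covered v e with minimal⇒<i (trans e (sym m≡2)) | only v e
      ... | j<i | inj₁ q = _ , subst (λ u → _~_ B u (y (wrap (suc (toℕ (p v))))))
              (trans (cong x (wrap-toℕ j<i)) (sym q)) (arc-mem j<i)
      ... | j<i | inj₂ q with predecessor 1≤i j<i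
      ...   | k , k<i , wk = _ , subst (λ u → _~_ B u (x (wrap k))) (trans (cong y wk) (sym q)) (~-sym B (arc-mem k<i))
      ys = tabulate (y ∘ among-first)
      lower-bound : ∀ B′ → RaisesRDN G B′ → i ≤ size B′
      lower-bound B′ raise = *-cancelˡ-≤ 2 (subst (_≤ 2 * size B′) length-xs++ys (covered≤2size B′ unique neighbours))
        where
        length-xs++ys : length (xs ++ ys) ≡ 2 * i
        length-xs++ys = trans (length-++ xs) (cong₂ _+_ (length-tabulate (x ∘ among-first))
          (trans (length-tabulate (y ∘ among-first)) (sym (+-identityʳ i))))
        ys-unique : Unique ys
        ys-unique = Unique.tabulate⁺ λ e → Fin.inject≤-injective i≤t i≤t _ _
          (trans (sym (py _)) (trans (cong p e) (py _)))
        unique : Unique (xs ++ ys)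
        unique = Unique.++⁺ xs-unique ys-unique λ (u∈xs , u∈ys) →
          case ∈-tabulate⁻ {f = x ∘ among-first} u∈xs , ∈-tabulate⁻ {f = y ∘ among-first} u∈ys of
            λ { ((j , refl) , (k , e)) → x≢y e }
        neighbours : ∀ {u} → u ∈ xs ++ ys → ∃ (_~_ B′ u)
        neighbours u∈ with ∈-++⁻ xs u∈
        ... | inj₁ u∈xs with ∈-tabulate⁻ {f = x ∘ among-first} u∈xs
        ...   | j , refl = covers B′ raise _ (among-first-size m≡2 j (px _))
        neighbours u∈ | inj₂ u∈ys with ∈-tabulate⁻ {f = y ∘ among-first} u∈ys
        ...   | j , refl = covers B′ raise _ (among-first-size m≡2 j (py _))

  module Star (v : Fin n) where

    Outside? : Decidable (λ u → p v ≢ p u)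
    Outside? u = ¬? (p v Fin.≟ p u)

    outside : List (Fin n)
    outside = filter Outside? (allFin n)

    star : List (Fin n × Fin n)
    star = map (v ,_) outside

    length-star : length star + partSize p (p v) ≤ n
    length-star = subst₂ (λ a b → a + b ≤ n) (sym (length-map (v ,_) outside)) refl
      (subst (_≤ n) (length-++ outside) (length-unique≤n (Unique.++⁺
        (Unique.filter⁺ Outside? (Unique.allFin⁺ n)) (part-unique (p v))
        λ (u∈out , u∈part) → proj₂ (∈-filter⁻ Outside? {xs = allFin n} u∈out) (sym (∈-part⁻ u∈part)))))

    -- `extra` leaves room for the additional arcs required when all parts have size 3.
    star-mem : ∀ extra w → p v ≢ p w → _~_ (arcSet G (star ++ extra)) v w
    star-mem extra w ne = arcSet-mem G
      (∈-++⁺ˡ (∈-map⁺ (v ,_) (∈-filter⁺ Outside? (∈-allFin w) ne))) (adj⁺ ne)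

  -- The star at `v` has `n - 3` edges. The two mates of `v` lie in a part too small to provide four
  -- non-neighbours, so each gets an edge to `d`.
  size-3 : partSize p 0F ≡ 3 → i ≡ suc (suc s) → 3 ≤ suc (suc s) → IsRomanBondageNumber G (n ∸ 1)
  size-3 m≡3 i≡t 3≤t = bondage-number B
    (star-raises p parts≥3 B ≤-refl 4<n v≢d (star-mem extra) (inj₂ ∘ covered))
    (≤-trans (size-arcSet G (star ++ extra)) short) lower-bound
    where
    size3 : ∀ j → partSize p j ≡ 3
    size3 j = trans (minimal j (subst (toℕ j <_) (sym i≡t) (Fin.toℕ<n j))) m≡3
    parts≥3 : ∀ j → 3 ≤ partSize p j
    parts≥3 j = ≤-reflexive (sym (size3 j))
    4<n : 4 < n
    4<n = ≤-trans (n≤1+n 5) (≤-trans (+-mono-≤ (parts≥3 0F) (parts≥3 last)) n≥)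
    v d : Fin n
    v = x 0F
    d = x 1F
    open Star v
    v≢d : p v ≢ p d
    v≢d e = case trans (sym (px 0F)) (trans e (px 1F)) of λ ()
    mates = filter (λ u → ¬? (u Fin.≟ v)) (part (p v))
    extra = map (_, d) mates
    B = arcSet G (star ++ extra)
    covered : ∀ u → ∃ (_~_ B u)
    covered u with p v Fin.≟ p u | u Fin.≟ v
    ... | no ne | _ = v , ~-sym B (star-mem extra u ne)
    ... | yes _ | yes refl = d , star-mem extra d v≢d
    ... | yes e | no u≢v = d , arcSet-mem G (∈-++⁺ʳ star (∈-map⁺ (_, d)
          (∈-filter⁺ (λ u → ¬? (u Fin.≟ v)) (∈-part⁺ (sym e)) u≢v))) (adj⁺ λ q → v≢d (trans e q))
    short : length (star ++ extra) ≤ n ∸ 1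
    short = m+n≤o⇒m≤o∸n (length (star ++ extra)) (begin
      length (star ++ extra) + 1            ≡⟨ cong (_+ 1) (length-++ star) ⟩
      length star + length extra + 1        ≡⟨ +-assoc (length star) _ 1 ⟩
      length star + (length extra + 1)      ≡⟨ cong (length star +_) (trans (+-comm _ 1) (cong suc (length-map (_, d) mates))) ⟩
      length star + suc (length mates)      ≤⟨ +-monoʳ-≤ (length star) (filter-notAll _ (part (p v)) (lose (∈-part⁺ refl) λ v≢v → v≢v refl)) ⟩
      length star + partSize p (p v)        ≤⟨ length-star ⟩
      n                                     ∎)
      where open ≤-Reasoning
    third : ∀ j k → ∃ λ u → p u ≢ j × p u ≢ k
    third j k with Fin.any? (λ l → ¬? (l ∈? (j ∷ k ∷ [])))
    ... | yes (l , l∉) = x l , (λ e → l∉ (here (trans (sym (px l)) e))) , (λ e → l∉ (there (here (trans (sym (px l)) e))))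
    ... | no none = contradiction (n≤length λ l → decidable-stable (l ∈? (j ∷ k ∷ [])) λ l∉ → none (l , l∉)) (<⇒≱ 3≤t)
    lower-bound : ∀ B′ → RaisesRDN G B′ → n ∸ 1 ≤ size B′
    lower-bound B′ raise = m≤n+o⇒m∸n≤o n 1 (Undominated.triple-bound p B′
      (raised-uncoverable p parts≥3 B′ ≤-refl (<⇒≤ 4<n) raise)
      (λ u → raised-covers p parts≥3 B′ ≤-refl (<⇒≤ 4<n) raise u (size3 (p u))) size3 third)

  -- The star is centred in a largest part: that part already provides four non-neighbours to each
  -- of its vertices, and all other vertices are covered by the star.
  size-≥3 : 3 ≤ partSize p 0F → 4 ≤ partSize p last → IsRomanBondageNumber G (n ∸ partSize p last)
  size-≥3 3≤m 4≤m = bondage-number B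
    (star-raises p parts≥3 B ≤-refl 4<n v≢w (star-mem []) big-or-covered)
    (≤-trans (size-arcSet G (star ++ [])) short) lower-bound
    where
    parts≥3 : ∀ j → 3 ≤ partSize p j
    parts≥3 j = ≤-trans 3≤m (parts≥ j)
    4<n : 4 < n
    4<n = ≤-trans (≤-trans (n≤1+n 5) (n≤1+n 6)) (≤-trans (+-mono-≤ 3≤m 4≤m) n≥)
    v : Fin n
    v = x last
    open Star v
    B = arcSet G (star ++ [])
    v≢w : p v ≢ p (x 0F)
    v≢w e = case trans (sym (px last)) (trans e (px 0F)) of λ ()
    big-or-covered : ∀ u → 4 ≤ partSize p (p u) ⊎ ∃ (_~_ B u)
    big-or-covered u with p v Fin.≟ p u
    ... | yes e = inj₁ (subst (λ j → 4 ≤ partSize p j) (trans (sym (px last)) e) 4≤m)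
    ... | no ne = inj₂ (v , ~-sym B (star-mem [] u ne))
    short : length (star ++ []) ≤ n ∸ partSize p last
    short = m+n≤o⇒m≤o∸n (length (star ++ [])) (subst₂ (λ a b → a + b ≤ n)
      (cong length (sym (++-identityʳ star))) (cong (partSize p) (px last)) length-star)
    lower-bound : ∀ B′ → RaisesRDN G B′ → n ∸ partSize p last ≤ size B′
    lower-bound B′ raise = m≤n+o⇒m∸n≤o n (partSize p last) (subst (n ≤_) (+-comm (size B′) _)
      (Undominated.size-bound p B′ (raised-uncoverable p parts≥3 B′ ≤-refl (<⇒≤ 4<n) raise) parts≤))

theorem3p1 : (s : ℕ) → 1 ≤ s → (m : Fin (suc s) → ℕ) → (i : ℕ) → (n : ℕ)
    → (p : Fin n → Fin (suc s))
    → (∀ j → partSize p j ≡ m j)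
    → (∀ j → 1 ≤ m j)
    → (∀ j k → toℕ j ≤ toℕ k → m j ≤ m k)
    → 1 ≤ i → i ≤ suc s
    → (∀ j → toℕ j < i → m j ≡ m zero)
    → (∀ j → i ≤ toℕ j → m zero < m j)
    → let G = completeMultipartite p in
    (m zero ≡ 1 → 3 ≤ n → IsRomanBondageNumber G ⌈ i /2⌉)
    × (m zero ≡ 2 → i ≡ 1 → IsRomanBondageNumber G 2)
    × (m zero ≡ 2 → 2 ≤ i → IsRomanBondageNumber G i)
    × (m zero ≡ 3 → i ≡ suc s → 3 ≤ suc s → IsRomanBondageNumber G (n ∸ 1))
    × (3 ≤ m zero → 4 ≤ m (fromℕ s) → IsRomanBondageNumber G (n ∸ m (fromℕ s)))
theorem3p1 (suc s) _ m i n p sizes nonempty monotone 1≤i i≤t minimal larger =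
  (λ m≡1 → size-1 (trans (sizes _) m≡1)) ,
  (λ m≡2 → Size2.single-part (trans (sizes _) m≡2)) ,
  (λ m≡2 → Size2.many-parts (trans (sizes _) m≡2)) ,
  (λ m≡3 → size-3 (trans (sizes _) m≡3)) ,
  λ 3≤m 4≤m → subst (λ k → IsRomanBondageNumber (completeMultipartite p) (n ∸ k)) (sizes _)
    (size-≥3 (subst (3 ≤_) (sym (sizes _)) 3≤m) (subst (4 ≤_) (sym (sizes _)) 4≤m))
  where
  open Bondage p
    (λ j k j≤k → subst₂ _≤_ (sym (sizes j)) (sym (sizes k)) (monotone j k j≤k))
    (λ j → subst (1 ≤_) (sym (sizes j)) (nonempty j)) 1≤i i≤t
    (λ j j<i → trans (sizes j) (trans (minimal j j<i) (sym (sizes _))))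
    (λ j i≤j → subst₂ _<_ (sym (sizes _)) (sym (sizes j)) (larger j i≤j))
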